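{- Let $G$ be a locally bipartite graph. If $\delta(G) > \frac{8}{15} |G|$, then $G$ is either $3$-colourable or contains $H_0$ or $T_0$ as a subgraph. If $\delta(G) > \frac{7}{13}|G|$, then $G$ is either $3$-colourable or contains $H_0$ as a subgraph.
   Context: Graphs are finite and simple; $|G|$ is the number of vertices, $\delta(G)$ the minimum degree. A graph is locally bipartite if the neighbourhood of every vertex induces a bipartite graph. $H_0$ (the Moser spindle) has vertices $a_0,\dots,a_6$ and edges $a_ia_{i+1}$ ($i=0,\dots,6$, indices mod 7) together with $a_0a_2$, $a_0a_5$, $a_1a_3$, $a_4a_6$. $T_0$ has vertices $v_0,\dots,v_6,u_1,u_6,t$ with edges $v_iv_{i+1}$ ($i$ mod 7), $u_1v_i$ for all $i\neq 1$, $u_6v_i$ for all $i \neq 6$, and $tv_0$, $tu_1$, $tu_6$ (and no other edges; in particular $u_1u_6$ is not an edge). -}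

module Defs where

open import Data.Nat using (ℕ; _+_; _*_; _<_)
open import Data.Bool using (Bool; true; false; if_then_else_; _∨_; _∧_)
open import Data.Fin using (Fin; zero; suc; _≟_; #_)
open import Data.List using (List; []; _∷_; map; allFin)
open import Data.Nat.ListAction using (sum)
open import Data.Bool.ListAction using (any)
open import Data.Product using (Σ; _×_; _,_; ∃)
open import Data.Sum using (_⊎_)
open import Relation.Nullary using (¬_)
open import Relation.Nullary.Decidable using (⌊_⌋)
open import Relation.Binary.PropositionalEquality using (_≡_; _≢_)
open import Function.Definitions using (Injective)

record Graph : Set where
  field
    n       : ℕ
    adj     : Fin n → Fin n → Bool
    symm    : ∀ x y → adj x y ≡ adj y x
    irrefl  : ∀ x → adj x x ≡ false
open Graph public

∣_∣ᵥ : Graph → ℕ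
∣ G ∣ᵥ = n G

deg : (G : Graph) → Fin (n G) → ℕ
deg G v = sum (map (λ w → if adj G v w then 1 else 0) (allFin (n G)))

MinDegGreater : (p q : ℕ) → Graph → Set
MinDegGreater p q G = ∀ v → p * ∣ G ∣ᵥ < q * deg G v

LocallyBipartite : Graph → Set
LocallyBipartite G =
  ∀ v → Σ (Fin (n G) → Bool) λ c →
    ∀ x y → adj G v x ≡ true → adj G v y ≡ true → adj G x y ≡ true → c x ≢ c y

ThreeColourable : Graph → Set
ThreeColourable G =
  Σ (Fin (n G) → Fin 3) λ c → ∀ x y → adj G x y ≡ true → c x ≢ c y

edgeAdj : ∀ {k} → List (Fin k × Fin k) → Fin k → Fin k → Bool
edgeAdj es x y =
  any (λ { (a , b) → (⌊ a ≟ x ⌋ ∧ ⌊ b ≟ y ⌋) ∨ (⌊ a ≟ y ⌋ ∧ ⌊ b ≟ x ⌋) }) es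

ContainsSubgraph : ∀ {k} → (Fin k → Fin k → Bool) → Graph → Set
ContainsSubgraph {k} H G =
  Σ (Fin k → Fin (n G)) λ f → Injective _≡_ _≡_ f ×
    (∀ i j → H i j ≡ true → adj G (f i) (f j) ≡ true)

-- Moser spindle H₀: vertex aᵢ is i
H₀ : Fin 7 → Fin 7 → Bool
H₀ = edgeAdj
  ( (# 0 , # 1) ∷ (# 1 , # 2) ∷ (# 2 , # 3) ∷ (# 3 , # 4) ∷ (# 4 , # 5) ∷ (# 5 , # 6) ∷ (# 6 , # 0)
  ∷ (# 0 , # 2) ∷ (# 0 , # 5) ∷ (# 1 , # 3) ∷ (# 4 , # 6) ∷ [])

-- T₀: vᵢ is i (0..6), u₁ is 7, u₆ is 8, t is 9
T₀ : Fin 10 → Fin 10 → Bool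
T₀ = edgeAdj
  ( (# 0 , # 1) ∷ (# 1 , # 2) ∷ (# 2 , # 3) ∷ (# 3 , # 4) ∷ (# 4 , # 5) ∷ (# 5 , # 6) ∷ (# 6 , # 0)
  ∷ (# 7 , # 0) ∷ (# 7 , # 2) ∷ (# 7 , # 3) ∷ (# 7 , # 4) ∷ (# 7 , # 5) ∷ (# 7 , # 6)
  ∷ (# 8 , # 0) ∷ (# 8 , # 1) ∷ (# 8 , # 2) ∷ (# 8 , # 3) ∷ (# 8 , # 4) ∷ (# 8 , # 5)
  ∷ (# 9 , # 0) ∷ (# 9 , # 7) ∷ (# 9 , # 8) ∷ [])

{-# OPTIONS --safe #-}

-- Call u, v dense if they have two adjacent common neighbours. In a locally bipartite graph, H₀ is
-- present as soon as some vertex is dense to both ends of an edge; assume it is absent.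
-- Let I be a maximum independent set. Since δ > n/2, two vertices of I are dense, for otherwise their
-- common neighbourhood would be a larger independent set; hence no vertex outside I is dense to one
-- of I. It suffices that G − I is bipartite, so consider a shortest odd closed walk C in G − I.
-- Every length is refuted by a weighting: if each vertex of G sees weight at most t out of a total W,
-- then δ ≤ (t/W) n. A vertex outside I sees at most two vertices of C when |C| ≥ 5, and a vertex of I
-- misses one, as there are no odd wheels; this excludes |C| ≥ 9. For |C| = 7 the weights, optimal
-- solutions of linear programs, depend on which single vertices of C are missed by some vertex of I.
module Submission where

open import Defs
open import Algebra.Properties.CommutativeSemigroup using (interchange; x∙yz≈y∙xz)
open import Data.Bool using (Bool; true; false; T; if_then_else_; not; _∧_; _∨_; _xor_)
open import Data.Bool.ListAction using (any; all)
import Data.Bool.Properties as Bool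
open import Data.Empty using (⊥; ⊥-elim)
open import Data.Fin using (Fin; #_)
import Data.Fin.Properties as Fin
open import Data.Fin.Subset using (Subset)
open import Data.Fin.Subset.Properties using (anySubset?)
open import Data.List using (List; []; _∷_; map; length; allFin; cartesianProduct)
open import Data.List.Membership.Propositional using (_∈_)
open import Data.List.Membership.Propositional.Properties using (∈-allFin; ∈-cartesianProduct⁺)
open import Data.List.Properties using (length-tabulate)
open import Data.List.Relation.Unary.All as All using (All; []; _∷_)
open import Data.List.Relation.Unary.Any using (here; there)
open import Data.Nat using (ℕ; zero; suc; _+_; _*_; _∸_; _≤_; _<_; z≤n; s≤s; _≤ᵇ_; _<?_)
open import Data.Nat.Induction using (<-rec)
open import Data.Nat.ListAction using (sum)
open import Data.Nat.Properties hiding (_≟_)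
open import Data.Nat.Solver using (module +-*-Solver)
open import Data.Product using (∃; _×_; _,_; proj₁; proj₂)
open import Data.Sum using (_⊎_; inj₁; inj₂)
open import Data.Vec using (Vec; []; _∷_; lookup; tabulate)
open import Data.Vec.Properties using (lookup∘tabulate)
open import Data.Vec.Relation.Unary.All using ([]; _∷_)
open import Data.Vec.Relation.Unary.AllPairs using ([]; _∷_)
open import Data.Vec.Relation.Unary.Unique.Propositional using (Unique)
open import Data.Vec.Relation.Unary.Unique.Propositional.Properties using (lookup-injective)
open import Function using (_∘_; const; case_of_)
open import Relation.Binary.PropositionalEquality
open import Relation.Nullary using (¬_; Dec; yes; no; contradiction)
open import Relation.Nullary.Decidable using (map′; ¬?; _×-dec_; _→-dec_; does)
open +-*-Solver using (solve; con; _:+_; _:*_; _:=_)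

private variable
  A : Set
  k l : ℕ

-- Sums over finite lists

sum-map-≤ : {f g : A → ℕ} (zs : List A) → (∀ z → f z ≤ g z) → sum (map f zs) ≤ sum (map g zs)
sum-map-≤ []       f≤g = z≤n
sum-map-≤ (z ∷ zs) f≤g = +-mono-≤ (f≤g z) (sum-map-≤ zs f≤g)

sum-map-+ : (f g : A → ℕ) (zs : List A) →
  sum (map (λ z → f z + g z) zs) ≡ sum (map f zs) + sum (map g zs)
sum-map-+ f g []       = refl
sum-map-+ f g (z ∷ zs) =
  trans (cong (f z + g z +_) (sum-map-+ f g zs)) (interchange +-commutativeSemigroup (f z) (g z) _ _)

sum-map-const : (t : ℕ) (zs : List A) → sum (map (const t) zs) ≡ length zs * t
sum-map-const t []       = refl
sum-map-const t (z ∷ zs) = cong (t +_) (sum-map-const t zs)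

sum-map-if : (c : ℕ) (p : A → Bool) (zs : List A) →
  sum (map (λ z → if p z then c else 0) zs) ≡ c * sum (map (λ z → if p z then 1 else 0) zs)
sum-map-if c p []       = sym (*-zeroʳ c)
sum-map-if c p (z ∷ zs) with p z
... | true  = trans (cong (c +_) (sum-map-if c p zs)) (sym (*-suc c _))
... | false = sum-map-if c p zs

∑ : (Fin k → ℕ) → ℕ
∑ f = sum (map f (allFin _))

ind : Bool → ℕ
ind b = if b then 1 else 0

card : (Fin k → Bool) → ℕ
card p = ∑ (λ z → ind (p z))

∑-const : ∀ k t → ∑ {k} (const t) ≡ k * t
∑-const k t = trans (sum-map-const t (allFin k)) (cong (_* t) (length-tabulate (λ (i : Fin k) → i)))

ind≤1 : ∀ b → ind b ≤ 1
ind≤1 true  = ≤-refl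
ind≤1 false = z≤n

card≤ : (p : Fin k → Bool) → card p ≤ k
card≤ {k} p = ≤-trans (sum-map-≤ (allFin k) (λ z → ind≤1 (p z)))
                      (≤-reflexive (trans (∑-const k 1) (*-identityʳ k)))

sum-map-∈ : (f : A → ℕ) {x : A} {zs : List A} → x ∈ zs → f x ≤ sum (map f zs)
sum-map-∈ f (here refl) = m≤m+n _ _
sum-map-∈ f (there x∈)  = ≤-trans (sum-map-∈ f x∈) (m≤n+m _ _)

card-pos : (p : Fin k → Bool) {x : Fin k} → p x ≡ true → 1 ≤ card p
card-pos p {x} px = ≤-trans (≤-reflexive (cong ind (sym px))) (sum-map-∈ (λ z → ind (p z)) (∈-allFin x))

-- Bounding a weight by exhausting the Boolean patterns that avoid given forbidden sets

weight : List ℕ → List Bool → ℕ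
weight (c ∷ cs) (b ∷ bs) = (if b then c else 0) + weight cs bs
weight _        _        = 0

at : List Bool → ℕ → Bool
at []       _       = false
at (b ∷ _)  zero    = b
at (_ ∷ bs) (suc i) = at bs i

Avoids : List Bool → List (List ℕ) → Set
Avoids bs = All (λ S → ¬ All (λ i → at bs i ≡ true) S)

allTrue : List Bool → List ℕ → Bool
allTrue bs = all (at bs)

everyPattern : ℕ → (List Bool → Bool) → Bool
everyPattern zero    f = f []
everyPattern (suc k) f = everyPattern k (λ bs → f (true ∷ bs)) ∧ everyPattern k (λ bs → f (false ∷ bs))

-- A Boolean test, so that with numeral weights and index lists a bound is proved by `refl`. The
-- enumeration is exponential in the number of weighted vertices, which is at most nine in every
-- use.
boundedBy : List ℕ → List (List ℕ) → ℕ → Bool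
boundedBy cs forbidden t =
  everyPattern (length cs) (λ bs → any (allTrue bs) forbidden ∨ (weight cs bs ≤ᵇ t))

∧-elim : ∀ {a b} → a ∧ b ≡ true → a ≡ true × b ≡ true
∧-elim {true} {true} refl = refl , refl

everyPattern-sound : ∀ k f → everyPattern k f ≡ true → ∀ bs → length bs ≡ k → f bs ≡ true
everyPattern-sound zero    f h []           refl = h
everyPattern-sound (suc k) f h (true ∷ bs)  refl = everyPattern-sound k _ (proj₁ (∧-elim h)) bs refl
everyPattern-sound (suc k) f h (false ∷ bs) refl = everyPattern-sound k _ (proj₂ (∧-elim h)) bs refl

allTrue-sound : ∀ bs S → allTrue bs S ≡ true → All (λ i → at bs i ≡ true) S
allTrue-sound bs []      h = []
allTrue-sound bs (i ∷ S) h = proj₁ (∧-elim h) ∷ allTrue-sound bs S (proj₂ (∧-elim h))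

avoids⇒none : ∀ bs {F} → Avoids bs F → any (allTrue bs) F ≡ false
avoids⇒none bs []                  = refl
avoids⇒none bs (_∷_ {S} ¬S avoids) with allTrue bs S in eq
... | true  = contradiction (allTrue-sound bs S eq) ¬S
... | false = avoids⇒none bs avoids

weight-bound : ∀ cs {F} t → boundedBy cs F t ≡ true →
  ∀ bs → length bs ≡ length cs → Avoids bs F → weight cs bs ≤ t
weight-bound cs {F} t h bs len avoids
  with any (allTrue bs) F | avoids⇒none bs avoids | everyPattern-sound (length cs) _ h bs len
... | .false | refl | ok = ≤ᵇ⇒≤ _ _ (subst T (sym ok) _)

-- Walks and two-colourings

odd : ℕ → Bool
odd zero    = false
odd (suc k) = not (odd k)

odd-+ : ∀ k l → odd (k + l) ≡ odd k xor odd l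
odd-+ zero    l = refl
odd-+ (suc k) l = trans (cong not (odd-+ k l)) (Bool.not-distribˡ-xor (odd k) (odd l))

infixr 5 _∷_

data Walk (R : A → A → Set) : ℕ → A → A → Set where
  []  : ∀ {x} → Walk R 0 x x
  _∷_ : ∀ {x y z} → R x y → Walk R k y z → Walk R (suc k) x z

module _ {R : A → A → Set} where

  infixr 5 _++ʷ_

  _++ʷ_ : ∀ {x y z} → Walk R k x y → Walk R l y z → Walk R (k + l) x z
  []      ++ʷ v = v
  (e ∷ w) ++ʷ v = e ∷ (w ++ʷ v)

  reverseʷ : (∀ {x y} → R x y → R y x) → ∀ {x y} → Walk R k x y → Walk R k y x
  reverseʷ symR []              = []
  reverseʷ symR {x} {y} (e ∷ w) =
    subst (λ l → Walk R l y x) (+-comm _ 1) (reverseʷ symR w ++ʷ (symR e ∷ []))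

  vertexAt : ∀ {x y} → Walk R k x y → ℕ → A
  vertexAt {x = x} _  zero    = x
  vertexAt {x = x} [] (suc i) = x
  vertexAt (_ ∷ w)    (suc i) = vertexAt w i

  vertexAt-end : ∀ {x y} (w : Walk R k x y) → vertexAt w k ≡ y
  vertexAt-end []      = refl
  vertexAt-end (_ ∷ w) = vertexAt-end w

  vertexAt-step : ∀ {x y} (w : Walk R k x y) i → i < k → R (vertexAt w i) (vertexAt w (suc i))
  vertexAt-step (e ∷ w) zero    _         = e
  vertexAt-step (_ ∷ w) (suc i) (s≤s i<k) = vertexAt-step w i i<k

  segment : (f : ℕ → A) → ∀ i d → (∀ j → i ≤ j → j < d + i → R (f j) (f (suc j))) → Walk R d (f i) (f (d + i))
  segment f i zero    step = []
  segment f i (suc d) step = step i ≤-refl (s≤s (m≤n+m i d)) ∷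
    subst (λ j → Walk R d (f (suc i)) (f j)) (+-suc d i)
      (segment f (suc i) d (λ j i<j j< → step j (<⇒≤ i<j) (subst (j <_) (+-suc d i) j<)))

  alternating : (c : A → Bool) → (∀ {x y} → R x y → c x ≢ c y) →
    ∀ {x y} → Walk R k x y → c y ≡ odd k xor c x
  alternating c proper [] = refl
  alternating {k = suc k} c proper {x} {y} (_∷_ {y = x′} e w) =
    trans (alternating c proper w)
      (trans (cong (odd k xor_) (Bool.¬-not (proper e ∘ sym)))
        (trans (sym (Bool.not-distribʳ-xor (odd k) (c x))) (Bool.not-distribˡ-xor (odd k) (c x))))

  -- Going round once flips the colour an odd number of times, yet returns to the starting colour.
  no-odd-closed : (c : A → Bool) → (∀ {x y} → R x y → c x ≢ c y) →
    ∀ {x} → odd k ≡ true → Walk R k x x → ⊥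
  no-odd-closed c proper {x} k-odd w =
    Bool.not-¬ {c x} refl (trans (alternating c proper w) (cong (_xor c x) k-odd))

xor-self : ∀ a b → a xor (a xor b) ≡ b
xor-self true  true  = refl
xor-self true  false = refl
xor-self false b     = refl

xor-injectiveˡ : ∀ c {a b} → a xor c ≡ b xor c → a ≡ b
xor-injectiveˡ c {true}  {true}  _  = refl
xor-injectiveˡ c {false} {false} _  = refl
xor-injectiveˡ c {true}  {false} eq = contradiction (sym eq) (Bool.not-¬ refl)
xor-injectiveˡ c {false} {true}  eq = contradiction eq (Bool.not-¬ refl)

-- Each vertex carries a representative of its component and the parity of a walk to it;
-- edges are added one at a time, merging components as in union-find.

module TwoColouring {m : ℕ} (R : Fin m → Fin m → Set) (R? : ∀ x y → Dec (R x y))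
  (symR : ∀ {x y} → R x y → R y x) (noOdd : ∀ {k x} → odd k ≡ true → Walk R k x x → ⊥) where

  WalkOf : Bool → Fin m → Fin m → Set
  WalkOf b x y = ∃ λ k → odd k ≡ b × Walk R k x y

  join : ∀ {a b x y z} → WalkOf a x y → WalkOf b y z → WalkOf (a xor b) x z
  join (k , refl , w) (l , refl , v) = k + l , odd-+ k l , w ++ʷ v

  flipWalk : ∀ {a x y} → WalkOf a x y → WalkOf a y x
  flipWalk (k , eq , w) = k , eq , reverseʷ symR w

  -- `proper` is conditional on `R`, so that `es` can simply run over all pairs of vertices.
  record Partial (es : List (Fin m × Fin m)) : Set where
    field
      rep    : Fin m → Fin m
      par    : Fin m → Bool
      path   : ∀ x → WalkOf (par x) x (rep x)
      proper : All (λ e → R (proj₁ e) (proj₂ e) →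
                     rep (proj₁ e) ≡ rep (proj₂ e) × par (proj₁ e) ≢ par (proj₂ e)) es

  module Merge {es} (P : Partial es) {x y : Fin m} (xy : R x y) (x≁y : Partial.rep P x ≢ Partial.rep P y) where
    open Partial P

    joins? : ∀ z → Dec (rep z ≡ rep y)
    joins? z = rep z Fin.≟ rep y

    -- The parity of the walk from `rep y` to `y`, across the new edge to `x`, and on to `rep x`.
    -- Adding it to the parities in the component of `y` turns that of `y` into `not (par x)`.
    shift : Bool
    shift = par y xor not (par x)

    bridge : WalkOf shift (rep y) (rep x)
    bridge = join (flipWalk (path y)) (join (1 , refl , symR xy ∷ []) (path x))

    rep′ : ∀ z → Dec (rep z ≡ rep y) → Fin m
    rep′ z (yes _) = rep x
    rep′ z (no _)  = rep z

    par′ : ∀ z → Dec (rep z ≡ rep y) → Bool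
    par′ z (yes _) = par z xor shift
    par′ z (no _)  = par z

    path′ : ∀ z d → WalkOf (par′ z d) z (rep′ z d)
    path′ z (yes eq) = join (subst (WalkOf (par z) z) eq (path z)) bridge
    path′ z (no _)   = path z

    keep : ∀ {a b} → rep a ≡ rep b × par a ≢ par b →
      ∀ d d′ → rep′ a d ≡ rep′ b d′ × par′ a d ≢ par′ b d′
    keep (_  , ne) (yes _)  (yes _)  = refl , ne ∘ xor-injectiveˡ shift
    keep (eq , _)  (yes a)  (no ¬b)  = contradiction (trans (sym eq) a) ¬b
    keep (eq , _)  (no ¬a)  (yes b)  = contradiction (trans eq b) ¬a
    keep (eq , ne) (no _)   (no _)   = eq , ne

    fresh : ∀ d d′ → rep′ x d ≡ rep′ y d′ × par′ x d ≢ par′ y d′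
    fresh (yes eq) _       = contradiction eq x≁y
    fresh _        (no ne) = contradiction refl ne
    fresh (no _)  (yes _)  = refl , λ eq →
      Bool.not-¬ refl (trans eq (xor-self (par y) _))

  open Partial

  addEdge : ∀ {es} x y → Partial es → Partial ((x , y) ∷ es)
  addEdge x y P with R? x y
  ... | no ¬xy = record { rep = rep P ; par = par P ; path = path P
                        ; proper = (λ xy → contradiction xy ¬xy) ∷ proper P }
  ... | yes xy with rep P x Fin.≟ rep P y
  ...   | no ne = record
    { rep = λ z → rep′ z (joins? z) ; par = λ z → par′ z (joins? z)
    ; path = λ z → path′ z (joins? z)
    ; proper = (λ _ → fresh (joins? x) (joins? y)) ∷
               All.map (λ {e} old r → keep (old r) (joins? (proj₁ e)) (joins? (proj₂ e))) (proper P) }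
    where open Merge P xy ne
  ...   | yes eq with par P x Bool.≟ par P y
  ...     | no ne  = record { rep = rep P ; par = par P ; path = path P
                            ; proper = (λ _ → eq , ne) ∷ proper P }
  -- Equal parities and a common representative: the paths from `x` and `y` to it, closed by the
  -- edge, form an odd closed walk.
  ...     | yes same = ⊥-elim (noOdd (trans (proj₁ (proj₂ loop)) loop-odd) (proj₂ (proj₂ loop)))
    where
      loop : WalkOf _ x x
      loop = join (subst (WalkOf _ x) eq (path P x))
               (join (flipWalk (path P y)) (1 , refl , symR xy ∷ []))
      loop-odd : par P x xor (par P y xor true) ≡ true
      loop-odd = trans (cong (_xor (par P y xor true)) same) (xor-self (par P y) true)

  colourAll : ∀ es → Partial es
  colourAll [] = record { rep = λ x → x ; par = λ _ → false ; path = λ _ → 0 , refl , [] ; proper = [] }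
  colourAll ((x , y) ∷ es) = addEdge x y (colourAll es)

  twoColouring : ∃ λ (c : Fin m → Bool) → ∀ x y → R x y → c x ≢ c y
  twoColouring = par P , λ x y xy →
    proj₂ (All.lookup (proper P) (∈-cartesianProduct⁺ (∈-allFin x) (∈-allFin y)) xy)
    where
      P : Partial (cartesianProduct (allFin m) (allFin m))
      P = colourAll _

-- Embeddings

anyVec? : ∀ k {P : Vec (Fin l) k → Set} → (∀ v → Dec (P v)) → Dec (∃ P)
anyVec? zero    P? = map′ (λ p → [] , p) (λ { ([] , p) → p }) (P? [])
anyVec? (suc k) P? = map′ (λ { (x , v , p) → x ∷ v , p }) (λ { (x ∷ v , p) → x , v , p })
  (Fin.any? (λ x → anyVec? k (λ v → P? (x ∷ v))))

-- Embeddings are searched among the finitely many vectors of vertices. Decidability is what allows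
-- a constructive case distinction on the presence of `H₀` and `T₀`.
containsSubgraph? : ∀ {k} (H : Fin k → Fin k → Bool) G → Dec (ContainsSubgraph H G)
containsSubgraph? {k} H G = map′ (λ { (v , inj , hom) → lookup v , (λ {i} {j} → inj i j) , hom }) toVec
  (anyVec? k λ v →
    Fin.all? (λ i → Fin.all? λ j → (lookup v i Fin.≟ lookup v j) →-dec (i Fin.≟ j)) ×-dec
    Fin.all? (λ i → Fin.all? λ j → (H i j Bool.≟ true) →-dec (adj G (lookup v i) (lookup v j) Bool.≟ true)))
  where
    toVec : ContainsSubgraph H G → ∃ λ v → (∀ i j → lookup v i ≡ lookup v j → i ≡ j) ×
      (∀ i j → H i j ≡ true → adj G (lookup v i) (lookup v j) ≡ true)
    toVec (f , inj , hom) = tabulate f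
      , (λ i j eq → inj (trans (sym (lookup∘tabulate f i)) (trans eq (lookup∘tabulate f j))))
      , (λ i j ij → trans (cong₂ (adj G) (lookup∘tabulate f i) (lookup∘tabulate f j)) (hom i j ij))

edgeAdj-hom : ∀ G {f : Fin k → Fin (n G)} es → All (λ e → adj G (f (proj₁ e)) (f (proj₂ e)) ≡ true) es →
  ∀ i j → edgeAdj es i j ≡ true → adj G (f i) (f j) ≡ true
edgeAdj-hom G {f} ((a , b) ∷ es) (ab ∷ rest) i j h with a Fin.≟ i | b Fin.≟ j | a Fin.≟ j | b Fin.≟ i
... | yes refl | yes refl | _        | _        = ab
... | _        | _        | yes refl | yes refl = trans (symm G _ _) ab
... | no _     | _        | no _     | _        = edgeAdj-hom G es rest i j h
... | no _     | _        | yes _    | no _     = edgeAdj-hom G es rest i j h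
... | yes _    | no _     | no _     | _        = edgeAdj-hom G es rest i j h
... | yes _    | no _     | yes _    | no _     = edgeAdj-hom G es rest i j h

contains : ∀ G (es : List (Fin k × Fin k)) (v : Vec (Fin (n G)) k) → Unique v →
  All (λ e → adj G (lookup v (proj₁ e)) (lookup v (proj₂ e)) ≡ true) es →
  ContainsSubgraph (edgeAdj es) G
contains G es v distinct edges = lookup v , (λ {i} {j} → lookup-injective distinct i j) , edgeAdj-hom G es edges

-- The literal list inside `H₀`, so that `edgeAdj H₀-edges` and `H₀` agree by unfolding; likewise
-- for `T₀-edges`.
H₀-edges : List (Fin 7 × Fin 7)
H₀-edges =
  (# 0 , # 1) ∷ (# 1 , # 2) ∷ (# 2 , # 3) ∷ (# 3 , # 4) ∷ (# 4 , # 5) ∷ (# 5 , # 6) ∷ (# 6 , # 0) ∷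
  (# 0 , # 2) ∷ (# 0 , # 5) ∷ (# 1 , # 3) ∷ (# 4 , # 6) ∷ []

T₀-edges : List (Fin 10 × Fin 10)
T₀-edges =
  (# 0 , # 1) ∷ (# 1 , # 2) ∷ (# 2 , # 3) ∷ (# 3 , # 4) ∷ (# 4 , # 5) ∷ (# 5 , # 6) ∷ (# 6 , # 0) ∷
  (# 7 , # 0) ∷ (# 7 , # 2) ∷ (# 7 , # 3) ∷ (# 7 , # 4) ∷ (# 7 , # 5) ∷ (# 7 , # 6) ∷
  (# 8 , # 0) ∷ (# 8 , # 1) ∷ (# 8 , # 2) ∷ (# 8 , # 3) ∷ (# 8 , # 4) ∷ (# 8 , # 5) ∷
  (# 9 , # 0) ∷ (# 9 , # 7) ∷ (# 9 , # 8) ∷ []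

-- Counting true values below a bound

count : (ℕ → Bool) → ℕ → ℕ
count b zero    = 0
count b (suc i) = ind (b i) + count b i

count-max : ∀ b l → count b l < l ⊎ (∀ i → i < l → b i ≡ true)
count-max b zero = inj₂ λ _ ()
count-max b (suc l) with b l in bl | count-max b l
... | true  | inj₁ less = inj₁ (s≤s less)
... | true  | inj₂ full = inj₂ λ i i<1+l → case m≤n⇒m<n∨m≡n (≤-pred i<1+l) of λ
        { (inj₁ i<l) → full i i<l ; (inj₂ refl) → bl }
... | false | inj₁ less = inj₁ (m≤n⇒m≤1+n less)
... | false | inj₂ full = inj₁ (s≤s (count≤ l))
  where
    count≤ : ∀ l → count b l ≤ l
    count≤ zero    = z≤n
    count≤ (suc l) = +-mono-≤ (ind≤1 (b l)) (count≤ l)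

-- Splits off the largest true index and leaves at least `c` true ones below it; iterating extracts
-- several positions in decreasing order.
count-last : ∀ b l {c} → suc c ≤ count b l → ∃ λ i → i < l × b i ≡ true × c ≤ count b i
count-last b (suc l) c< with b l in bl
... | true  = l , ≤-refl , bl , ≤-pred c<
... | false with count-last b l c<
...   | i , i<l , bi , c≤ = i , m≤n⇒m≤1+n i<l , bi , c≤

-- On a closed walk of odd length `e + (d + i)`, an even arc `d` leaves a complementary arc `e + i`
-- that is odd. The `1` is one of the two edges with which `gap` closes that arc.
odd-gap : ∀ e d i → odd (e + (d + i)) ≡ true → odd d ≡ false → odd (e + (i + 1)) ≡ false
odd-gap e d i odd-L even-d
  rewrite odd-+ e (d + i) | odd-+ d i | even-d | odd-+ e (i + 1) | odd-+ i 1
  with odd e | odd i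
... | true  | false = refl
... | false | true  = refl

-- Weighted degree counting

module GraphFacts (G : Graph) where

  V : Set
  V = Fin (n G)

  infix 4 _~_

  _~_ : V → V → Set
  x ~ y = adj G x y ≡ true

  ~-sym : ∀ {x y} → x ~ y → y ~ x
  ~-sym {x} {y} xy = trans (symm G y x) xy

  ~-irrefl : ∀ {x} → ¬ x ~ x
  ~-irrefl {x} xx = case trans (sym (irrefl G x)) xx of λ ()

  ~⇒≢ : ∀ {x y} → x ~ y → x ≢ y
  ~⇒≢ xy refl = ~-irrefl xy

  Dense : V → V → Set
  Dense u v = ∃ λ p → ∃ λ q → (u ~ p × u ~ q) × (v ~ p × v ~ q) × p ~ q

  Dense-sym : ∀ {u v} → Dense u v → Dense v u
  Dense-sym (p , q , up , vp , pq) = p , q , vp , up , pq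

  Independent : (V → Bool) → Set
  Independent S = ∀ x y → S x ≡ true → S y ≡ true → ¬ x ~ y

  weights : List (ℕ × V) → List ℕ
  weights []             = []
  weights ((c , _) ∷ xs) = c ∷ weights xs

  total : List (ℕ × V) → ℕ
  total xs = sum (weights xs)

  seenBy : List (ℕ × V) → V → List Bool
  seenBy []             z = []
  seenBy ((_ , v) ∷ xs) z = adj G v z ∷ seenBy xs z

  seenWeight : List (ℕ × V) → V → ℕ
  seenWeight xs z = weight (weights xs) (seenBy xs z)

  length-seenBy : ∀ xs z → length (seenBy xs z) ≡ length (weights xs)
  length-seenBy []       z = refl
  length-seenBy (_ ∷ xs) z = cong suc (length-seenBy xs z)

  -- Summing weighted degrees vertex by vertex, then exchanging the order of summation. Each unit of
  -- weight keeps the `suc` of the strict degree bound, which later makes the contradiction strict.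
  degrees : ∀ p q → MinDegGreater p q G → ∀ xs →
    total xs * suc (p * n G) ≤ q * ∑ (seenWeight xs)
  degrees p q md [] = z≤n
  degrees p q md ((c , v) ∷ xs) = begin
    (c + total xs) * suc (p * n G)                      ≡⟨ *-distribʳ-+ (suc (p * n G)) c (total xs) ⟩
    c * suc (p * n G) + total xs * suc (p * n G)        ≤⟨ +-mono-≤ (*-monoʳ-≤ c (md v)) (degrees p q md xs) ⟩
    c * (q * deg G v) + q * ∑ (seenWeight xs)           ≡⟨
      cong (_+ q * ∑ (seenWeight xs)) (x∙yz≈y∙xz *-commutativeSemigroup c q (deg G v)) ⟩
    q * (c * deg G v) + q * ∑ (seenWeight xs)           ≡⟨
      cong (λ d → q * d + q * ∑ (seenWeight xs)) (sum-map-if c (adj G v) (allFin (n G))) ⟨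
    q * ∑ (λ z → if adj G v z then c else 0) + q * ∑ (seenWeight xs)
                                                        ≡⟨ *-distribˡ-+ q (∑ (λ z → if adj G v z then c else 0)) (∑ (seenWeight xs)) ⟨
    q * (∑ (λ z → if adj G v z then c else 0) + ∑ (seenWeight xs))
                                                        ≡⟨ cong (q *_) (sum-map-+ _ (seenWeight xs) (allFin (n G))) ⟨
    q * ∑ (seenWeight ((c , v) ∷ xs))                   ∎
    where open ≤-Reasoning

  -- Double counting: the weighted degree sum exceeds (p/q)·n·total, so some vertex sees more than t.
  overweight± : ∀ p q → MinDegGreater p q G → ∀ xs t (P Q : V → Bool) →
    0 < total xs → q * t ≤ p * total xs → card Q ≤ card P →
    (∀ z → seenWeight xs z + ind (P z) ≤ t + ind (Q z)) → ⊥
  overweight± p q md xs t P Q pos qt≤ Q≤P bound = <-irrefl refl (begin-strict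
    total xs * (p * n G)               <⟨ m<n+m _ pos ⟩
    total xs + total xs * (p * n G)    ≡⟨ *-suc (total xs) (p * n G) ⟨
    total xs * suc (p * n G)           ≤⟨ degrees p q md xs ⟩
    q * ∑ (seenWeight xs)              ≤⟨ *-monoʳ-≤ q small ⟩
    q * (n G * t)                      ≡⟨ x∙yz≈y∙xz *-commutativeSemigroup q (n G) t ⟩
    n G * (q * t)                      ≤⟨ *-monoʳ-≤ (n G) qt≤ ⟩
    n G * (p * total xs)               ≡⟨ *-comm (n G) (p * total xs) ⟩
    p * total xs * n G                 ≡⟨ cong (_* n G) (*-comm p (total xs)) ⟩
    total xs * p * n G                 ≡⟨ *-assoc (total xs) p (n G) ⟩
    total xs * (p * n G)               ∎)
    where
      open ≤-Reasoning
      -- `P` and `Q` redistribute one unit per vertex: members of `Q` may exceed `t` by one if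
      -- members of `P` stay one below. As `card Q ≤ card P`, this costs nothing on summing.
      small : ∑ (seenWeight xs) ≤ n G * t
      small = +-cancelʳ-≤ (card P) _ _ (begin
        ∑ (seenWeight xs) + card P                 ≡⟨ sum-map-+ (seenWeight xs) (λ z → ind (P z)) (allFin (n G)) ⟨
        ∑ (λ z → seenWeight xs z + ind (P z))      ≤⟨ sum-map-≤ (allFin (n G)) bound ⟩
        ∑ (λ z → t + ind (Q z))                    ≡⟨ sum-map-+ (const t) (λ z → ind (Q z)) (allFin (n G)) ⟩
        ∑ {n G} (const t) + card Q                 ≡⟨ cong (_+ card Q) (∑-const (n G) t) ⟩
        n G * t + card Q                           ≤⟨ +-monoʳ-≤ (n G * t) Q≤P ⟩
        n G * t + card P                           ∎)

  overweight : ∀ p q → MinDegGreater p q G → ∀ xs t →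
    0 < total xs → q * t ≤ p * total xs → (∀ z → seenWeight xs z ≤ t) → ⊥
  overweight p q md xs t pos qt≤ bound =
    overweight± p q md xs t (const false) (const false) pos qt≤ ≤-refl (λ z → +-monoˡ-≤ 0 (bound z))

  seenWeight-bound : ∀ xs {F} t → boundedBy (weights xs) F t ≡ true →
    ∀ {z} → Avoids (seenBy xs z) F → seenWeight xs z ≤ t
  seenWeight-bound xs t h {z} = weight-bound (weights xs) t h (seenBy xs z) (length-seenBy xs z)

  -- Maximum independent sets

  independent? : ∀ (S : Subset (n G)) → Dec (Independent (lookup S))
  independent? S = Fin.all? λ x → Fin.all? λ y →
    (lookup S x Bool.≟ true) →-dec ((lookup S y Bool.≟ true) →-dec ¬? (adj G x y Bool.≟ true))

  record Maximum : Set where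
    field
      I     : V → Bool
      indep : Independent I
      max   : ∀ S → Independent S → card S ≤ card I

  -- Each improvement raises `card S` by at least one and uses one unit of fuel, which preserves
  -- `n G ≤ card S + fuel`; with no fuel left, `S` already has `n G` elements.
  climb : ∀ fuel (S : V → Bool) → Independent S → n G ≤ card S + fuel → Maximum
  climb zero S ind-S full = record { I = S ; indep = ind-S
    ; max = λ S′ _ → ≤-trans (card≤ S′) (≤-trans full (≤-reflexive (+-identityʳ _))) }
  climb (suc fuel) S ind-S room
    with anySubset? (λ S′ → independent? S′ ×-dec (card S <? card (lookup S′)))
  ... | yes (S′ , ind-S′ , S<S′) = climb fuel (lookup S′) ind-S′
          (≤-trans room (≤-trans (≤-reflexive (+-suc _ fuel)) (+-monoˡ-≤ fuel S<S′)))
  ... | no none = record { I = S ; indep = ind-S ; max = λ S′ ind-S′ → ≮⇒≥ λ S<S′ →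
          none (tabulate S′
               , (λ x y Sx Sy → ind-S′ x y (untab Sx) (untab Sy))
               , ≤-trans S<S′ (sum-map-≤ (allFin (n G)) (λ z → ≤-reflexive (cong ind (sym (lookup∘tabulate S′ z)))))) }
    where
      untab : ∀ {S′ : V → Bool} {x} → lookup (tabulate S′) x ≡ true → S′ x ≡ true
      untab {S′} {x} = trans (sym (lookup∘tabulate S′ x))

  maximum : Maximum
  maximum = climb (n G) (const false) (λ _ _ ()) (m≤n+m (n G) _)

  -- Odd wheels and Moser spindles in locally bipartite graphs

  module _ (lb : LocallyBipartite G) where

    Around : V → V → V → Set
    Around h x y = x ~ y × h ~ x × h ~ y

    -- The rim lies in the neighbourhood of `h`, which local bipartiteness two-colours.
    noWheel : ∀ h {k x} → odd k ≡ true → Walk (Around h) k x x → ⊥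
    noWheel h = no-odd-closed (proj₁ (lb h)) (λ { {x} {y} (xy , hx , hy) → proj₂ (lb h) x y hx hy xy })

    noK₄ : ∀ {a b c d} → a ~ b → a ~ c → a ~ d → b ~ c → b ~ d → c ~ d → ⊥
    noK₄ {a} ab ac ad bc bd cd = noWheel a refl ((bc , ab , ac) ∷ (cd , ac , ad) ∷ (~-sym bd , ad , ab) ∷ [])

    no5Wheel : ∀ h {a b c d e} → h ~ a → h ~ b → h ~ c → h ~ d → h ~ e →
      a ~ b → b ~ c → c ~ d → d ~ e → e ~ a → ⊥
    no5Wheel h ha hb hc hd he ab bc cd de ea = noWheel h refl
      ((ab , ha , hb) ∷ (bc , hb , hc) ∷ (cd , hc , hd) ∷ (de , hd , he) ∷ (ea , he , ha) ∷ [])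

    no7Wheel : ∀ h {a b c d e f g} → h ~ a → h ~ b → h ~ c → h ~ d → h ~ e → h ~ f → h ~ g →
      a ~ b → b ~ c → c ~ d → d ~ e → e ~ f → f ~ g → g ~ a → ⊥
    no7Wheel h ha hb hc hd he hf hg ab bc cd de ef fg ga = noWheel h refl
      ((ab , ha , hb) ∷ (bc , hb , hc) ∷ (cd , hc , hd) ∷ (de , hd , he) ∷
       (ef , he , hf) ∷ (fg , hf , hg) ∷ (ga , hg , ha) ∷ [])

    adjacent-dense⇒⊥ : ∀ {u v} → u ~ v → Dense u v → ⊥
    adjacent-dense⇒⊥ uv (p , q , (up , uq) , (vp , vq) , pq) = noK₄ uv up uq vp vq pq

    -- The density witnesses form two diamonds `u p q v` and `u r s w` with common tip `u`, and
    -- `v ~ w` joins the other tips.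
    moserSpindle : ∀ {u v w} → Dense u v → Dense u w → v ~ w → ContainsSubgraph H₀ G
    moserSpindle {u} {v} {w} uv@(p , q , (up , uq) , (vp , vq) , pq)
      uw@(r , s , (ur , us) , (wr , ws) , rs) vw =
      contains G H₀-edges (u ∷ p ∷ q ∷ v ∷ w ∷ r ∷ s ∷ [])
        ( (~⇒≢ up ∷ ~⇒≢ uq ∷ (λ { refl → adjacent-dense⇒⊥ vw uw }) ∷
           (λ { refl → adjacent-dense⇒⊥ (~-sym vw) uv }) ∷ ~⇒≢ ur ∷ ~⇒≢ us ∷ [])
        ∷ (~⇒≢ pq ∷ ~⇒≢ (~-sym vp) ∷ (λ { refl → adjacent-dense⇒⊥ up uw }) ∷
           shared up uq vp vq pq ur us wr ws rs ∷ shared up uq vp vq pq us ur ws wr (~-sym rs) ∷ [])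
        ∷ (~⇒≢ (~-sym vq) ∷ (λ { refl → adjacent-dense⇒⊥ uq uw }) ∷
           shared uq up vq vp (~-sym pq) ur us wr ws rs ∷ shared uq up vq vp (~-sym pq) us ur ws wr (~-sym rs) ∷ [])
        ∷ (~⇒≢ vw ∷ (λ { refl → adjacent-dense⇒⊥ ur uv }) ∷ (λ { refl → adjacent-dense⇒⊥ us uv }) ∷ [])
        ∷ (~⇒≢ wr ∷ ~⇒≢ ws ∷ [])
        ∷ (~⇒≢ rs ∷ [])
        ∷ [] ∷ [])
        (up ∷ pq ∷ ~-sym vq ∷ vw ∷ wr ∷ rs ∷ ~-sym us ∷ uq ∷ ur ∷ ~-sym vp ∷ ws ∷ [])
      where
        -- If the diamonds shared a middle vertex `p`, it would be the hub of a 5-wheel with rim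
        -- `u q v w s`.
        shared : ∀ {p q r s} → u ~ p → u ~ q → v ~ p → v ~ q → p ~ q →
          u ~ r → u ~ s → w ~ r → w ~ s → r ~ s → p ≢ r
        shared {p} up uq vp vq pq ur us wr ws rs refl =
          no5Wheel p (~-sym up) pq (~-sym vp) (~-sym wr) rs uq (~-sym vq) vw ws (~-sym us)

-- Spindle-free graphs

module SpindleFree (G : Graph) (lb : LocallyBipartite G) (md : MinDegGreater 8 15 G)
  (noSpindle : ∀ {u v w} → GraphFacts.Dense G u v → GraphFacts.Dense G u w → ¬ GraphFacts._~_ G v w) where

  open GraphFacts G
  open Maximum maximum

  dense? : ∀ u v → Dec (Dense u v)
  dense? u v = Fin.any? λ p → Fin.any? λ q →
    ((adj G u p Bool.≟ true) ×-dec (adj G u q Bool.≟ true)) ×-dec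
    ((adj G v p Bool.≟ true) ×-dec (adj G v q Bool.≟ true)) ×-dec (adj G p q Bool.≟ true)

  common : V → V → V → Bool
  common u v z = adj G u z ∧ adj G v z

  -- An edge inside the common neighbourhood would witness density, so it is independent and
  -- maximality of `I` applies.
  sparse⇒common-small : ∀ {u v} → ¬ Dense u v → card (common u v) ≤ card I
  sparse⇒common-small sparse = max _ λ p q up uq pq →
    let (up , vp) = ∧-elim up ; (uq , vq) = ∧-elim uq in sparse (p , q , (up , uq) , (vp , vq) , pq)

  -- Otherwise the common neighbourhood would be an independent set larger than I.
  I-dense : ∀ {u v} → I u ≡ true → I v ≡ true → Dense u v
  I-dense {u} {v} Iu Iv with dense? u v
  ... | yes d = d
  ... | no ¬d = ⊥-elim (overweight± 8 15 md ((1 , u) ∷ (1 , v) ∷ []) 1 I (common u v)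
                  (s≤s z≤n) (≤ᵇ⇒≤ 15 16 _) (sparse⇒common-small ¬d) bound)
    where
      bound : ∀ z → seenWeight ((1 , u) ∷ (1 , v) ∷ []) z + ind (I z) ≤ 1 + ind (common u v z)
      bound z with I z in Iz | adj G u z in uz | adj G v z in vz
      ... | true  | true  | _     = ⊥-elim (indep u z Iu Iz uz)
      ... | true  | false | true  = ⊥-elim (indep v z Iv Iz vz)
      ... | true  | false | false = ≤-refl
      ... | false | true  | true  = ≤-refl
      ... | false | true  | false = ≤-refl
      ... | false | false | true  = ≤-refl
      ... | false | false | false = z≤n

  -- Otherwise `v` could be added to `I`, against its maximality.
  neighbourInI : ∀ {v} → I v ≡ false → ∃ λ w → I w ≡ true × v ~ w
  neighbourInI {v} ∉v with Fin.any? (λ w → (I w Bool.≟ true) ×-dec (adj G v w Bool.≟ true))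
  ... | yes found = found
  ... | no none   = contradiction (max I+v independent) (<⇒≱ larger)
    where
      isV : V → Bool
      isV x = does (x Fin.≟ v)

      I+v : V → Bool
      I+v x = I x ∨ isV x

      independent : Independent I+v
      independent x y x∈ y∈ xy with I x in Ix | I y in Iy | x Fin.≟ v | y Fin.≟ v
      ... | true  | true  | _        | _        = indep x y Ix Iy xy
      ... | true  | false | _        | yes refl = none (x , Ix , ~-sym xy)
      ... | false | true  | yes refl | _        = none (y , Iy , xy)
      ... | false | false | yes refl | yes refl = ~-irrefl xy

      step : ∀ x → ind (isV x) + ind (I x) ≤ ind (I+v x)
      step x with x Fin.≟ v
      ... | yes refl rewrite ∉v = ≤-refl
      ... | no _ with I x
      ...   | true  = ≤-refl
      ...   | false = ≤-refl

      isV-v : isV v ≡ true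
      isV-v with v Fin.≟ v
      ... | yes _ = refl
      ... | no ne = contradiction refl ne

      larger : suc (card I) ≤ card I+v
      larger = begin
        1 + card I                            ≤⟨ +-monoˡ-≤ (card I) (card-pos isV {v} isV-v) ⟩
        card isV + card I                     ≡⟨ sum-map-+ (λ x → ind (isV x)) (λ x → ind (I x)) (allFin (n G)) ⟨
        ∑ (λ x → ind (isV x) + ind (I x))     ≤⟨ sum-map-≤ (allFin (n G)) step ⟩
        card I+v                              ∎
        where open ≤-Reasoning

  -- A neighbour `w` of `v` in `I` is dense to `u`; were `v` dense to `u` too, the edge `v w` would
  -- complete a spindle.
  sparse : ∀ {u v} → I u ≡ true → I v ≡ false → ¬ Dense u v
  sparse Iu ∉v uv with neighbourInI ∉v
  ... | w , Iw , vw = noSpindle uv (I-dense Iu Iw) vw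

  -- Vertices inside and outside `I` avoid different patterns, hence two forbidden lists for one
  -- bound `t`. With numerals the four arithmetic premises hold by evaluation; only the reasons for
  -- the forbidden sets remain.
  overweightᴵ : ∀ p q → MinDegGreater p q G → ∀ xs t Fᴵ Fᴼ →
    T (1 ≤ᵇ total xs) → T (q * t ≤ᵇ p * total xs) →
    boundedBy (weights xs) Fᴵ t ≡ true → boundedBy (weights xs) Fᴼ t ≡ true →
    (∀ z → I z ≡ true → Avoids (seenBy xs z) Fᴵ) → (∀ z → I z ≡ false → Avoids (seenBy xs z) Fᴼ) → ⊥
  overweightᴵ p q md xs t Fᴵ Fᴼ pos qt≤ okᴵ okᴼ inside outside =
    overweight p q md xs t (≤ᵇ⇒≤ _ _ pos) (≤ᵇ⇒≤ _ _ qt≤) bound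
    where
      bound : ∀ z → seenWeight xs z ≤ t
      bound z with I z in Iz
      ... | true  = seenWeight-bound xs t okᴵ (inside z Iz)
      ... | false = seenWeight-bound xs t okᴼ (outside z Iz)

  -- Here x, y, z force the colours of a, b, c, so u is left without one.
  cap : ∀ {u a b c x y z} → u ~ a → u ~ b → u ~ c → x ~ y → x ~ z → y ~ z →
    a ~ x → a ~ y → b ~ x → b ~ z → c ~ y → c ~ z → ⊥
  cap {u} {a} {b} {c} {x} {y} {z} ua ub uc xy xz yz ax ay bx bz cy cz =
    overweight 8 15 md xs 4 (s≤s z≤n) (≤ᵇ⇒≤ 60 64 _) λ t → seenWeight-bound xs {F} 4 refl
      ( (λ { (xt ∷ yt ∷ zt ∷ []) → noK₄ lb xy xz xt yz yt zt })
      ∷ (λ { (xt ∷ yt ∷ at ∷ []) → noK₄ lb ax ay at xy xt yt })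
      ∷ (λ { (xt ∷ zt ∷ bt ∷ []) → noK₄ lb bx bz bt xz xt zt })
      ∷ (λ { (yt ∷ zt ∷ ct ∷ []) → noK₄ lb cy cz ct yz yt zt })
      ∷ (λ { (ut ∷ xt ∷ at ∷ []) → x-u (a , t , (~-sym ax , xt) , (ua , ut) , at) })
      ∷ (λ { (ut ∷ xt ∷ bt ∷ []) → x-u (b , t , (~-sym bx , xt) , (ub , ut) , bt) })
      ∷ (λ { (ut ∷ yt ∷ at ∷ []) → y-u (a , t , (~-sym ay , yt) , (ua , ut) , at) })
      ∷ (λ { (ut ∷ yt ∷ ct ∷ []) → y-u (c , t , (~-sym cy , yt) , (uc , ut) , ct) })
      ∷ (λ { (ut ∷ zt ∷ bt ∷ []) → z-u (b , t , (~-sym bz , zt) , (ub , ut) , bt) })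
      ∷ (λ { (ut ∷ zt ∷ ct ∷ []) → z-u (c , t , (~-sym cz , zt) , (uc , ut) , ct) })
      ∷ (λ { (ut ∷ at ∷ bt ∷ []) → a-b (u , t , (~-sym ua , at) , (~-sym ub , bt) , ut) })
      ∷ (λ { (ut ∷ at ∷ ct ∷ []) → a-c (u , t , (~-sym ua , at) , (~-sym uc , ct) , ut) })
      ∷ (λ { (ut ∷ bt ∷ ct ∷ []) → b-c (u , t , (~-sym ub , bt) , (~-sym uc , ct) , ut) })
      ∷ (λ { (at ∷ bt ∷ xt ∷ []) → a-b (x , t , (ax , at) , (bx , bt) , xt) })
      ∷ (λ { (at ∷ ct ∷ yt ∷ []) → a-c (y , t , (ay , at) , (cy , ct) , yt) })
      ∷ (λ { (bt ∷ ct ∷ zt ∷ []) → b-c (z , t , (bz , bt) , (cz , ct) , zt) })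
      ∷ [])
    where
      xs : List (ℕ × V)
      xs = (2 , u) ∷ (1 , a) ∷ (1 , b) ∷ (1 , c) ∷ (1 , x) ∷ (1 , y) ∷ (1 , z) ∷ []

      F : List (List ℕ)
      F = (4 ∷ 5 ∷ 6 ∷ []) ∷ (4 ∷ 5 ∷ 1 ∷ []) ∷ (4 ∷ 6 ∷ 2 ∷ []) ∷ (5 ∷ 6 ∷ 3 ∷ []) ∷
          (0 ∷ 4 ∷ 1 ∷ []) ∷ (0 ∷ 4 ∷ 2 ∷ []) ∷ (0 ∷ 5 ∷ 1 ∷ []) ∷ (0 ∷ 5 ∷ 3 ∷ []) ∷
          (0 ∷ 6 ∷ 2 ∷ []) ∷ (0 ∷ 6 ∷ 3 ∷ []) ∷
          (0 ∷ 1 ∷ 2 ∷ []) ∷ (0 ∷ 1 ∷ 3 ∷ []) ∷ (0 ∷ 2 ∷ 3 ∷ []) ∷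
          (1 ∷ 2 ∷ 4 ∷ []) ∷ (1 ∷ 3 ∷ 5 ∷ []) ∷ (2 ∷ 3 ∷ 6 ∷ []) ∷ []

      -- Each triangle vertex is dense to the attached vertex that sees the other two. Any further
      -- density among the pairs below would share an end with one of these and close a spindle
      -- across an existing edge.
      x-c : Dense x c
      x-c = y , z , (xy , xz) , (cy , cz) , yz
      y-b : Dense y b
      y-b = x , z , (~-sym xy , yz) , (bx , bz) , xz
      z-a : Dense z a
      z-a = x , y , (~-sym xz , ~-sym yz) , (ax , ay) , xy

      x-u : ¬ Dense x u
      x-u d = noSpindle x-c d (~-sym uc)
      y-u : ¬ Dense y u
      y-u d = noSpindle y-b d (~-sym ub)
      z-u : ¬ Dense z u
      z-u d = noSpindle z-a d (~-sym ua)
      a-b : ¬ Dense a b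
      a-b d = noSpindle d (Dense-sym z-a) bz
      a-c : ¬ Dense a c
      a-c d = noSpindle d (Dense-sym z-a) cz
      b-c : ¬ Dense b c
      b-c d = noSpindle d (Dense-sym y-b) cy

  -- Give `u`, `x`, `y`, `z` weight 1. A vertex of `I` seeing two of the triangle would be dense to
  -- the third, so it sees at most one. Without a common neighbour of `u`, `y`, `z`, a vertex
  -- outside `I` sees at most two, or three if it is common to `u` and `x`; those are no more
  -- numerous than `I`, and `overweight±` trades the excess.
  commonNeighbour : ∀ {u x y z} → I u ≡ true → I x ≡ false → I y ≡ false → I z ≡ false →
    x ~ y → x ~ z → y ~ z → ∃ λ c → u ~ c × c ~ y × c ~ z
  commonNeighbour {u} {x} {y} {z} Iu ∉x ∉y ∉z xy xz yz
    with Fin.any? (λ c → (adj G u c Bool.≟ true) ×-dec (adj G c y Bool.≟ true) ×-dec (adj G c z Bool.≟ true))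
  ... | yes found = found
  ... | no none   = ⊥-elim (overweight± 8 15 md xs 2 I (common u x) (s≤s z≤n) (≤ᵇ⇒≤ 30 32 _)
                      (sparse⇒common-small (sparse Iu ∉x)) bound)
    where
      xs : List (ℕ × V)
      xs = (1 , u) ∷ (1 , x) ∷ (1 , y) ∷ (1 , z) ∷ []

      Fᴵ Fᴼ : List (List ℕ)
      Fᴵ = (0 ∷ []) ∷ (1 ∷ 2 ∷ []) ∷ (1 ∷ 3 ∷ []) ∷ (2 ∷ 3 ∷ []) ∷ []
      Fᴼ = (1 ∷ 2 ∷ 3 ∷ []) ∷ (0 ∷ 2 ∷ 3 ∷ []) ∷ []

      avoidᴵ : ∀ t → I t ≡ true → Avoids (seenBy xs t) Fᴵ
      avoidᴵ t It =
        (λ { (ut ∷ []) → indep u t Iu It ut }) ∷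
        (λ { (xt ∷ yt ∷ []) → sparse It ∉z (x , y , (~-sym xt , ~-sym yt) , (~-sym xz , ~-sym yz) , xy) }) ∷
        (λ { (xt ∷ zt ∷ []) → sparse It ∉y (x , z , (~-sym xt , ~-sym zt) , (~-sym xy , yz) , xz) }) ∷
        (λ { (yt ∷ zt ∷ []) → sparse It ∉x (y , z , (~-sym yt , ~-sym zt) , (xy , xz) , yz) }) ∷ []

      avoidᴼ : ∀ t → Avoids (seenBy xs t) Fᴼ
      avoidᴼ t =
        (λ { (xt ∷ yt ∷ zt ∷ []) → noK₄ lb xy xz xt yz yt zt }) ∷
        (λ { (ut ∷ yt ∷ zt ∷ []) → none (t , ut , ~-sym yt , ~-sym zt) }) ∷ []

      bound : ∀ t → seenWeight xs t + ind (I t) ≤ 2 + ind (common u x t)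
      bound t with I t in It
      ... | true  = +-mono-≤ (seenWeight-bound xs {Fᴵ} 1 refl (avoidᴵ t It)) (m≤m+n 1 _)
      ... | false with adj G u t ∧ adj G x t in uxt
      ...   | true  = ≤-trans (≤-reflexive (+-identityʳ _)) (seenWeight-bound xs {Fᴼ} 3 refl (avoidᴼ t))
      ...   | false = +-monoˡ-≤ 0 (seenWeight-bound xs {(0 ∷ 1 ∷ []) ∷ Fᴼ} 2 refl
                        ((λ { (ut ∷ xt ∷ []) → case trans (sym uxt) (cong₂ _∧_ ut xt) of λ () }) ∷ avoidᴼ t))

  -- For one `u` in `I`, the three pairs of the triangle each have a common neighbour with `u`,
  -- which is the configuration excluded by `cap`.
  triangle : ∀ {x y z} → I x ≡ false → I y ≡ false → I z ≡ false → x ~ y → x ~ z → y ~ z → ⊥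
  triangle ∉x ∉y ∉z xy xz yz with neighbourInI ∉x
  ... | u , Iu , _
    with commonNeighbour Iu ∉x ∉y ∉z xy xz yz
       | commonNeighbour Iu ∉y ∉x ∉z (~-sym xy) yz xz
       | commonNeighbour Iu ∉z ∉x ∉y (~-sym xz) (~-sym yz) xy
  ... | c , uc , cy , cz | b , ub , bx , bz | a , ua , ax , ay =
    cap ua ub uc xy xz yz ax ay bx bz cy cz

  -- Five-cycles outside the independent set

  record Cycle₅ : Set where
    field
      v0 v1 v2 v3 v4 : V
      ∉0 : I v0 ≡ false
      ∉1 : I v1 ≡ false
      ∉2 : I v2 ≡ false
      ∉3 : I v3 ≡ false
      ∉4 : I v4 ≡ false
      e01 : v0 ~ v1
      e12 : v1 ~ v2
      e23 : v2 ~ v3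
      e34 : v3 ~ v4
      e40 : v4 ~ v0

  rot₅ : Cycle₅ → Cycle₅
  rot₅ c = record
    { v0 = v1 ; v1 = v2 ; v2 = v3 ; v3 = v4 ; v4 = v0
    ; ∉0 = ∉1 ; ∉1 = ∉2 ; ∉2 = ∉3 ; ∉3 = ∉4 ; ∉4 = ∉0
    ; e01 = e12 ; e12 = e23 ; e23 = e34 ; e34 = e40 ; e40 = e01 }
    where open Cycle₅ c

  -- No vertex sees more than two of `v4`, `v0`, `v1`, `w`. Inside `I`, seeing `v4`, `v0`, `v1`
  -- makes `v1` dense to `v4`, while `w` makes it dense to `v3`. Outside `I`, seeing `v4`, `v1`, `w`
  -- means replacing `v0` to obtain a 5-wheel with hub `w`.
  noHub₅ : ∀ (c : Cycle₅) → let open Cycle₅ c in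
    ∀ {w} → I w ≡ true → v1 ~ w → v2 ~ w → v3 ~ w → v4 ~ w → ⊥
  noHub₅ c {w} Iw 1w 2w 3w 4w = overweightᴵ 8 15 md
    ((1 , v4) ∷ (1 , v0) ∷ (1 , v1) ∷ (1 , w) ∷ []) 2
    ((3 ∷ []) ∷ (0 ∷ 1 ∷ 2 ∷ []) ∷ [])
    ((1 ∷ 2 ∷ []) ∷ (0 ∷ 1 ∷ []) ∷ (0 ∷ 2 ∷ 3 ∷ []) ∷ []) _ _ refl refl
    (λ z Iz → (λ { (wz ∷ []) → indep w z Iw Iz wz })
            ∷ (λ { (4z ∷ 0z ∷ 1z ∷ []) → noSpindle
                    (v2 , w , (e12 , 1w) , (~-sym e23 , 3w) , 2w)
                    (v0 , z , (~-sym e01 , 1z) , (e40 , 4z) , 0z) e34 }) ∷ [])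
    (λ z ∉z → (λ { (0z ∷ 1z ∷ []) → triangle ∉0 ∉1 ∉z e01 0z 1z })
            ∷ (λ { (4z ∷ 0z ∷ []) → triangle ∉4 ∉0 ∉z e40 4z 0z })
            ∷ (λ { (4z ∷ 1z ∷ wz ∷ []) → no5Wheel lb w (~-sym 1w) (~-sym 2w) (~-sym 3w) (~-sym 4w) wz
                                           e12 e23 e34 4z (~-sym 1z) }) ∷ [])
    where open Cycle₅ c

  -- With unit weights on the cycle and some `u` in `I`, vertices of `I` see at most three by
  -- `noHub₅`; others see at most two on the cycle, as there are no triangles, plus `u`.
  noCycle₅ : ¬ Cycle₅
  noCycle₅ c with neighbourInI (Cycle₅.∉0 c)
  ... | u , Iu , _ = overweightᴵ 8 15 md
    ((1 , v0) ∷ (1 , v1) ∷ (1 , v2) ∷ (1 , v3) ∷ (1 , v4) ∷ (1 , u) ∷ []) 3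
    ((5 ∷ []) ∷ (1 ∷ 2 ∷ 3 ∷ 4 ∷ []) ∷ (2 ∷ 3 ∷ 4 ∷ 0 ∷ []) ∷ (3 ∷ 4 ∷ 0 ∷ 1 ∷ []) ∷
     (4 ∷ 0 ∷ 1 ∷ 2 ∷ []) ∷ (0 ∷ 1 ∷ 2 ∷ 3 ∷ []) ∷ [])
    ((0 ∷ 1 ∷ []) ∷ (1 ∷ 2 ∷ []) ∷ (2 ∷ 3 ∷ []) ∷ (3 ∷ 4 ∷ []) ∷ (4 ∷ 0 ∷ []) ∷ []) _ _ refl refl
    (λ z Iz → (λ { (uz ∷ []) → indep u z Iu Iz uz })
            ∷ (λ { (a ∷ b ∷ d ∷ e ∷ []) → noHub₅ c Iz a b d e })
            ∷ (λ { (a ∷ b ∷ d ∷ e ∷ []) → noHub₅ (rot₅ c) Iz a b d e })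
            ∷ (λ { (a ∷ b ∷ d ∷ e ∷ []) → noHub₅ (rot₅ (rot₅ c)) Iz a b d e })
            ∷ (λ { (a ∷ b ∷ d ∷ e ∷ []) → noHub₅ (rot₅ (rot₅ (rot₅ c))) Iz a b d e })
            ∷ (λ { (a ∷ b ∷ d ∷ e ∷ []) → noHub₅ (rot₅ (rot₅ (rot₅ (rot₅ c)))) Iz a b d e }) ∷ [])
    (λ z ∉z → (λ { (p ∷ q ∷ []) → triangle ∉0 ∉1 ∉z e01 p q })
            ∷ (λ { (p ∷ q ∷ []) → triangle ∉1 ∉2 ∉z e12 p q })
            ∷ (λ { (p ∷ q ∷ []) → triangle ∉2 ∉3 ∉z e23 p q })
            ∷ (λ { (p ∷ q ∷ []) → triangle ∉3 ∉4 ∉z e34 p q })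
            ∷ (λ { (p ∷ q ∷ []) → triangle ∉4 ∉0 ∉z e40 p q }) ∷ [])
    where open Cycle₅ c

  pentagon : ∀ {a b c d z} → I a ≡ false → I b ≡ false → I c ≡ false → I d ≡ false → I z ≡ false →
    a ~ b → b ~ c → c ~ d → a ~ z → d ~ z → ⊥
  pentagon ∉a ∉b ∉c ∉d ∉z ab bc cd az dz = noCycle₅ record
    { ∉0 = ∉a ; ∉1 = ∉b ; ∉2 = ∉c ; ∉3 = ∉d ; ∉4 = ∉z ; e01 = ab ; e12 = bc ; e23 = cd ; e34 = dz ; e40 = ~-sym az }

  -- Seven-cycles and their hubs

  record Cycle₇ : Set where
    field
      v0 v1 v2 v3 v4 v5 v6 : V
      ∉0 : I v0 ≡ false
      ∉1 : I v1 ≡ false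
      ∉2 : I v2 ≡ false
      ∉3 : I v3 ≡ false
      ∉4 : I v4 ≡ false
      ∉5 : I v5 ≡ false
      ∉6 : I v6 ≡ false
      e01 : v0 ~ v1
      e12 : v1 ~ v2
      e23 : v2 ~ v3
      e34 : v3 ~ v4
      e45 : v4 ~ v5
      e56 : v5 ~ v6
      e60 : v6 ~ v0

  rot : Cycle₇ → Cycle₇
  rot c = record
    { v0 = v1 ; v1 = v2 ; v2 = v3 ; v3 = v4 ; v4 = v5 ; v5 = v6 ; v6 = v0
    ; ∉0 = ∉1 ; ∉1 = ∉2 ; ∉2 = ∉3 ; ∉3 = ∉4 ; ∉4 = ∉5 ; ∉5 = ∉6 ; ∉6 = ∉0
    ; e01 = e12 ; e12 = e23 ; e23 = e34 ; e34 = e45 ; e45 = e56 ; e56 = e60 ; e60 = e01 }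
    where open Cycle₇ c

  -- `Hub (rot^ j c)` concerns a hub missing the vertex `j` steps along `c`. Seven rotations give
  -- back `c` by record eta, so indices are reduced modulo 7 by conversion.
  rot^ : ℕ → Cycle₇ → Cycle₇
  rot^ zero    c = c
  rot^ (suc j) c = rot (rot^ j c)

  -- A vertex of I whose only non-neighbour on the cycle is v0.
  record Hub (c : Cycle₇) : Set where
    open Cycle₇ c
    field
      w  : V
      ∈I : I w ≡ true
      h1 : v1 ~ w
      h2 : v2 ~ w
      h3 : v3 ~ w
      h4 : v4 ~ w
      h5 : v5 ~ w
      h6 : v6 ~ w

  hub? : ∀ c → Dec (Hub c)
  hub? c = map′
    (λ { (w , ∈I , h1 , h2 , h3 , h4 , h5 , h6) → record
      { w = w ; ∈I = ∈I ; h1 = h1 ; h2 = h2 ; h3 = h3 ; h4 = h4 ; h5 = h5 ; h6 = h6 } })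
    (λ h → let open Hub h in w , ∈I , h1 , h2 , h3 , h4 , h5 , h6)
    (Fin.any? λ w → (I w Bool.≟ true) ×-dec
      (adj G v1 w Bool.≟ true) ×-dec (adj G v2 w Bool.≟ true) ×-dec (adj G v3 w Bool.≟ true) ×-dec
      (adj G v4 w Bool.≟ true) ×-dec (adj G v5 w Bool.≟ true) ×-dec (adj G v6 w Bool.≟ true))
    where open Cycle₇ c

  noHub⇒avoid : ∀ {c} → ¬ Hub c → let open Cycle₇ c in ∀ {z} → I z ≡ true →
    v1 ~ z → v2 ~ z → v3 ~ z → v4 ~ z → v5 ~ z → v6 ~ z → ⊥
  noHub⇒avoid ¬h {z} Iz h1 h2 h3 h4 h5 h6 = ¬h record
    { w = z ; ∈I = Iz ; h1 = h1 ; h2 = h2 ; h3 = h3 ; h4 = h4 ; h5 = h5 ; h6 = h6 }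

  wholeCycle : ∀ c → let open Cycle₇ c in ∀ {z} →
    v0 ~ z → v1 ~ z → v2 ~ z → v3 ~ z → v4 ~ z → v5 ~ z → v6 ~ z → ⊥
  wholeCycle c {z} h0 h1 h2 h3 h4 h5 h6 =
    no7Wheel lb z (~-sym h0) (~-sym h1) (~-sym h2) (~-sym h3) (~-sym h4) (~-sym h5) (~-sym h6)
      e01 e12 e23 e34 e45 e56 e60
    where open Cycle₇ c

  -- Such a z could replace v0 in the cycle, which would then lie in the neighbourhood of the hub.
  hub-twin : ∀ {c} (h : Hub c) → let open Cycle₇ c in ∀ {z} → v6 ~ z → v1 ~ z → Hub.w h ~ z → ⊥
  hub-twin {c} h {z} 6z 1z wz =
    no7Wheel lb w wz (~-sym h1) (~-sym h2) (~-sym h3) (~-sym h4) (~-sym h5) (~-sym h6)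
      (~-sym 1z) e12 e23 e34 e45 e56 6z
    where
      open Cycle₇ c
      open Hub h

  -- Pairs at cyclic distance one (triangles) and three (pentagons). What remains are pairs at
  -- distance two, so a vertex outside `I` sees at most two cycle vertices.
  cycleForbidden : List (List ℕ)
  cycleForbidden =
    (0 ∷ 1 ∷ []) ∷ (1 ∷ 2 ∷ []) ∷ (2 ∷ 3 ∷ []) ∷ (3 ∷ 4 ∷ []) ∷ (4 ∷ 5 ∷ []) ∷ (5 ∷ 6 ∷ []) ∷ (6 ∷ 0 ∷ []) ∷
    (0 ∷ 3 ∷ []) ∷ (1 ∷ 4 ∷ []) ∷ (2 ∷ 5 ∷ []) ∷ (3 ∷ 6 ∷ []) ∷ (4 ∷ 0 ∷ []) ∷ (5 ∷ 1 ∷ []) ∷ (6 ∷ 2 ∷ []) ∷ []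

  avoidCycle : ∀ c → let open Cycle₇ c in ∀ z → I z ≡ false → ∀ {bs} →
    Avoids (adj G v0 z ∷ adj G v1 z ∷ adj G v2 z ∷ adj G v3 z ∷ adj G v4 z ∷ adj G v5 z ∷ adj G v6 z ∷ bs) cycleForbidden
  avoidCycle c z ∉z =
    (λ { (p ∷ q ∷ []) → triangle ∉0 ∉1 ∉z e01 p q }) ∷
    (λ { (p ∷ q ∷ []) → triangle ∉1 ∉2 ∉z e12 p q }) ∷
    (λ { (p ∷ q ∷ []) → triangle ∉2 ∉3 ∉z e23 p q }) ∷
    (λ { (p ∷ q ∷ []) → triangle ∉3 ∉4 ∉z e34 p q }) ∷
    (λ { (p ∷ q ∷ []) → triangle ∉4 ∉5 ∉z e45 p q }) ∷
    (λ { (p ∷ q ∷ []) → triangle ∉5 ∉6 ∉z e56 p q }) ∷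
    (λ { (p ∷ q ∷ []) → triangle ∉6 ∉0 ∉z e60 p q }) ∷
    (λ { (p ∷ q ∷ []) → pentagon ∉0 ∉1 ∉2 ∉3 ∉z e01 e12 e23 p q }) ∷
    (λ { (p ∷ q ∷ []) → pentagon ∉1 ∉2 ∉3 ∉4 ∉z e12 e23 e34 p q }) ∷
    (λ { (p ∷ q ∷ []) → pentagon ∉2 ∉3 ∉4 ∉5 ∉z e23 e34 e45 p q }) ∷
    (λ { (p ∷ q ∷ []) → pentagon ∉3 ∉4 ∉5 ∉6 ∉z e34 e45 e56 p q }) ∷
    (λ { (p ∷ q ∷ []) → pentagon ∉4 ∉5 ∉6 ∉0 ∉z e45 e56 e60 p q }) ∷
    (λ { (p ∷ q ∷ []) → pentagon ∉5 ∉6 ∉0 ∉1 ∉z e56 e60 e01 p q }) ∷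
    (λ { (p ∷ q ∷ []) → pentagon ∉6 ∉0 ∉1 ∉2 ∉z e60 e01 e12 p q }) ∷
    []
    where open Cycle₇ c

  -- Out of 10, vertices of `I` see at most five cycle vertices and not `u`; others see at most two
  -- cycle vertices and `u`, again weight 5.
  noHub : ∀ c → ¬ Hub c → ¬ Hub (rot^ 1 c) → ¬ Hub (rot^ 2 c) → ¬ Hub (rot^ 3 c) →
    ¬ Hub (rot^ 4 c) → ¬ Hub (rot^ 5 c) → ¬ Hub (rot^ 6 c) → ⊥
  noHub c ¬0 ¬1 ¬2 ¬3 ¬4 ¬5 ¬6 with neighbourInI (Cycle₇.∉0 c)
  ... | u , Iu , _ = overweightᴵ 8 15 md
    ((1 , v0) ∷ (1 , v1) ∷ (1 , v2) ∷ (1 , v3) ∷ (1 , v4) ∷ (1 , v5) ∷ (1 , v6) ∷ (3 , u) ∷ []) 5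
    ((7 ∷ []) ∷ (1 ∷ 2 ∷ 3 ∷ 4 ∷ 5 ∷ 6 ∷ []) ∷
     (2 ∷ 3 ∷ 4 ∷ 5 ∷ 6 ∷ 0 ∷ []) ∷ (3 ∷ 4 ∷ 5 ∷ 6 ∷ 0 ∷ 1 ∷ []) ∷ (4 ∷ 5 ∷ 6 ∷ 0 ∷ 1 ∷ 2 ∷ []) ∷
     (5 ∷ 6 ∷ 0 ∷ 1 ∷ 2 ∷ 3 ∷ []) ∷ (6 ∷ 0 ∷ 1 ∷ 2 ∷ 3 ∷ 4 ∷ []) ∷ (0 ∷ 1 ∷ 2 ∷ 3 ∷ 4 ∷ 5 ∷ []) ∷ [])
    cycleForbidden _ _ refl refl
    (λ z Iz → (λ { (uz ∷ []) → indep u z Iu Iz uz })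
            ∷ (λ { (a ∷ b ∷ d ∷ e ∷ f ∷ g ∷ []) → noHub⇒avoid ¬0 Iz a b d e f g })
            ∷ (λ { (a ∷ b ∷ d ∷ e ∷ f ∷ g ∷ []) → noHub⇒avoid ¬1 Iz a b d e f g })
            ∷ (λ { (a ∷ b ∷ d ∷ e ∷ f ∷ g ∷ []) → noHub⇒avoid ¬2 Iz a b d e f g })
            ∷ (λ { (a ∷ b ∷ d ∷ e ∷ f ∷ g ∷ []) → noHub⇒avoid ¬3 Iz a b d e f g })
            ∷ (λ { (a ∷ b ∷ d ∷ e ∷ f ∷ g ∷ []) → noHub⇒avoid ¬4 Iz a b d e f g })
            ∷ (λ { (a ∷ b ∷ d ∷ e ∷ f ∷ g ∷ []) → noHub⇒avoid ¬5 Iz a b d e f g })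
            ∷ (λ { (a ∷ b ∷ d ∷ e ∷ f ∷ g ∷ []) → noHub⇒avoid ¬6 Iz a b d e f g }) ∷ [])
    (λ z ∉z → avoidCycle c z ∉z)
    where open Cycle₇ c

  -- The doubled vertices `v6`, `v0`, `v1` are those that a vertex of `I` may miss alone, which
  -- leaves it 8 of the 10 on the cycle. Outside `I`, only the pair `v6`, `v1` weighs 4, and
  -- `hub-twin` forbids seeing it together with `w`; so 8 of 15 is attained but not exceeded.
  hubsNear : ∀ c → Hub c → ¬ Hub (rot^ 2 c) → ¬ Hub (rot^ 3 c) → ¬ Hub (rot^ 4 c) → ¬ Hub (rot^ 5 c) → ⊥
  hubsNear c h ¬2 ¬3 ¬4 ¬5 = overweightᴵ 8 15 md
    ((2 , v0) ∷ (2 , v1) ∷ (1 , v2) ∷ (1 , v3) ∷ (1 , v4) ∷ (1 , v5) ∷ (2 , v6) ∷ (5 , w) ∷ []) 8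
    ((7 ∷ []) ∷ (0 ∷ 1 ∷ 2 ∷ 3 ∷ 4 ∷ 5 ∷ 6 ∷ []) ∷
     (3 ∷ 4 ∷ 5 ∷ 6 ∷ 0 ∷ 1 ∷ []) ∷ (4 ∷ 5 ∷ 6 ∷ 0 ∷ 1 ∷ 2 ∷ []) ∷ (5 ∷ 6 ∷ 0 ∷ 1 ∷ 2 ∷ 3 ∷ []) ∷
     (6 ∷ 0 ∷ 1 ∷ 2 ∷ 3 ∷ 4 ∷ []) ∷ [])
    ((6 ∷ 1 ∷ 7 ∷ []) ∷ cycleForbidden) _ _ refl refl
    (λ z Iz → (λ { (wz ∷ []) → indep w z ∈I Iz wz })
            ∷ (λ { (a ∷ b ∷ d ∷ e ∷ f ∷ g ∷ h ∷ []) → wholeCycle c a b d e f g h })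
            ∷ (λ { (a ∷ b ∷ d ∷ e ∷ f ∷ g ∷ []) → noHub⇒avoid ¬2 Iz a b d e f g })
            ∷ (λ { (a ∷ b ∷ d ∷ e ∷ f ∷ g ∷ []) → noHub⇒avoid ¬3 Iz a b d e f g })
            ∷ (λ { (a ∷ b ∷ d ∷ e ∷ f ∷ g ∷ []) → noHub⇒avoid ¬4 Iz a b d e f g })
            ∷ (λ { (a ∷ b ∷ d ∷ e ∷ f ∷ g ∷ []) → noHub⇒avoid ¬5 Iz a b d e f g }) ∷ [])
    (λ z ∉z → (λ { (6z ∷ 1z ∷ wz ∷ []) → hub-twin h 6z 1z wz }) ∷ avoidCycle c z ∉z)
    where
      open Cycle₇ c
      open Hub h

  -- As in `hubsNear`, but the vertices that may be missed alone are `v0`, `v3`, `v4`. No two of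
  -- them are at distance two, so a vertex outside `I` sees at most 3 on the cycle, plus 5 for `w`.
  hubsFar : ∀ c → Hub c → ¬ Hub (rot^ 1 c) → ¬ Hub (rot^ 2 c) → ¬ Hub (rot^ 5 c) → ¬ Hub (rot^ 6 c) → ⊥
  hubsFar c h ¬1 ¬2 ¬5 ¬6 = overweightᴵ 8 15 md
    ((2 , v0) ∷ (1 , v1) ∷ (1 , v2) ∷ (2 , v3) ∷ (2 , v4) ∷ (1 , v5) ∷ (1 , v6) ∷ (5 , w) ∷ []) 8
    ((7 ∷ []) ∷ (0 ∷ 1 ∷ 2 ∷ 3 ∷ 4 ∷ 5 ∷ 6 ∷ []) ∷
     (2 ∷ 3 ∷ 4 ∷ 5 ∷ 6 ∷ 0 ∷ []) ∷ (3 ∷ 4 ∷ 5 ∷ 6 ∷ 0 ∷ 1 ∷ []) ∷ (6 ∷ 0 ∷ 1 ∷ 2 ∷ 3 ∷ 4 ∷ []) ∷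
     (0 ∷ 1 ∷ 2 ∷ 3 ∷ 4 ∷ 5 ∷ []) ∷ [])
    ((6 ∷ 1 ∷ 7 ∷ []) ∷ cycleForbidden) _ _ refl refl
    (λ z Iz → (λ { (wz ∷ []) → indep w z ∈I Iz wz })
            ∷ (λ { (a ∷ b ∷ d ∷ e ∷ f ∷ g ∷ h ∷ []) → wholeCycle c a b d e f g h })
            ∷ (λ { (a ∷ b ∷ d ∷ e ∷ f ∷ g ∷ []) → noHub⇒avoid ¬1 Iz a b d e f g })
            ∷ (λ { (a ∷ b ∷ d ∷ e ∷ f ∷ g ∷ []) → noHub⇒avoid ¬2 Iz a b d e f g })
            ∷ (λ { (a ∷ b ∷ d ∷ e ∷ f ∷ g ∷ []) → noHub⇒avoid ¬5 Iz a b d e f g })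
            ∷ (λ { (a ∷ b ∷ d ∷ e ∷ f ∷ g ∷ []) → noHub⇒avoid ¬6 Iz a b d e f g }) ∷ [])
    (λ z ∉z → (λ { (6z ∷ 1z ∷ wz ∷ []) → hub-twin h 6z 1z wz }) ∷ avoidCycle c z ∉z)
    where
      open Cycle₇ c
      open Hub h

  ∉≢∈ : ∀ {x y} → I x ≡ false → I y ≡ true → x ≢ y
  ∉≢∈ ∉x Iy refl = case trans (sym ∉x) Iy of λ ()

  -- Most of the work is distinctness: cycle vertices coinciding at distance two leave a pentagon,
  -- at distance three a triangle. If `u₁` and `u₆` coincided, or `t` were `v1` or `v6`, a hub would
  -- see the whole cycle.
  containsT₀ : ∀ c (h₁ : Hub (rot^ 1 c)) (h₆ : Hub (rot^ 6 c)) →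
    ∀ {t} → I t ≡ false → Cycle₇.v0 c ~ t → Hub.w h₁ ~ t → Hub.w h₆ ~ t → ContainsSubgraph T₀ G
  containsT₀ c h₁ h₆ {t} ∉t 0t 1t 6t = contains G T₀-edges
    (v0 ∷ v1 ∷ v2 ∷ v3 ∷ v4 ∷ v5 ∷ v6 ∷ u₁ ∷ u₆ ∷ t ∷ [])
    ( (~⇒≢ e01 ∷
        (λ { refl → pentagon ∉2 ∉3 ∉4 ∉5 ∉6 e23 e34 e45 (~-sym e60) e56 }) ∷
        (λ { refl → triangle ∉0 ∉1 ∉2 e01 (~-sym e23) e12 }) ∷
        (λ { refl → triangle ∉4 ∉5 ∉6 e45 (~-sym e60) e56 }) ∷
        (λ { refl → pentagon ∉0 ∉1 ∉2 ∉3 ∉4 e01 e12 e23 (~-sym e45) e34 }) ∷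
        (~⇒≢ e60 ∘ sym) ∷
        ∉≢∈ ∉0 ∈₁ ∷
        ∉≢∈ ∉0 ∈₆ ∷
        ~⇒≢ 0t ∷ [])
    ∷ (~⇒≢ e12 ∷
        (λ { refl → pentagon ∉3 ∉4 ∉5 ∉6 ∉0 e34 e45 e56 (~-sym e01) e60 }) ∷
        (λ { refl → triangle ∉1 ∉2 ∉3 e12 (~-sym e34) e23 }) ∷
        (λ { refl → triangle ∉5 ∉6 ∉0 e56 (~-sym e01) e60 }) ∷
        (λ { refl → pentagon ∉1 ∉2 ∉3 ∉4 ∉5 e12 e23 e34 (~-sym e56) e45 }) ∷
        ∉≢∈ ∉1 ∈₁ ∷
        ∉≢∈ ∉1 ∈₆ ∷
        (λ { refl → wholeCycle c a0 (~-sym 1t) a2 a3 a4 a5 a6 }) ∷ [])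
    ∷ (~⇒≢ e23 ∷
        (λ { refl → pentagon ∉4 ∉5 ∉6 ∉0 ∉1 e45 e56 e60 (~-sym e12) e01 }) ∷
        (λ { refl → triangle ∉2 ∉3 ∉4 e23 (~-sym e45) e34 }) ∷
        (λ { refl → triangle ∉6 ∉0 ∉1 e60 (~-sym e12) e01 }) ∷
        ∉≢∈ ∉2 ∈₁ ∷
        ∉≢∈ ∉2 ∈₆ ∷
        (λ { refl → triangle ∉0 ∉1 ∉2 e01 0t e12 }) ∷ [])
    ∷ (~⇒≢ e34 ∷
        (λ { refl → pentagon ∉5 ∉6 ∉0 ∉1 ∉2 e56 e60 e01 (~-sym e23) e12 }) ∷
        (λ { refl → triangle ∉3 ∉4 ∉5 e34 (~-sym e56) e45 }) ∷
        ∉≢∈ ∉3 ∈₁ ∷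
        ∉≢∈ ∉3 ∈₆ ∷
        (λ { refl → pentagon ∉3 ∉4 ∉5 ∉6 ∉0 e34 e45 e56 (~-sym 0t) e60 }) ∷ [])
    ∷ (~⇒≢ e45 ∷
        (λ { refl → pentagon ∉6 ∉0 ∉1 ∉2 ∉3 e60 e01 e12 (~-sym e34) e23 }) ∷
        ∉≢∈ ∉4 ∈₁ ∷
        ∉≢∈ ∉4 ∈₆ ∷
        (λ { refl → pentagon ∉0 ∉1 ∉2 ∉3 ∉4 e01 e12 e23 0t e34 }) ∷ [])
    ∷ (~⇒≢ e56 ∷
        ∉≢∈ ∉5 ∈₁ ∷
        ∉≢∈ ∉5 ∈₆ ∷
        (λ { refl → triangle ∉5 ∉6 ∉0 e56 (~-sym 0t) e60 }) ∷ [])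
    ∷ (∉≢∈ ∉6 ∈₁ ∷
        ∉≢∈ ∉6 ∈₆ ∷
        (λ { refl → wholeCycle c b0 b1 b2 b3 b4 b5 (~-sym 6t) }) ∷ [])
    ∷ ((λ { refl → wholeCycle c a0 b1 a2 a3 a4 a5 a6 }) ∷ ~⇒≢ 1t ∷ [])
    ∷ (~⇒≢ 6t ∷ [])
    ∷ [] ∷ [])
    (e01 ∷ e12 ∷ e23 ∷ e34 ∷ e45 ∷ e56 ∷ e60 ∷
     ~-sym a0 ∷ ~-sym a2 ∷ ~-sym a3 ∷ ~-sym a4 ∷ ~-sym a5 ∷ ~-sym a6 ∷
     ~-sym b0 ∷ ~-sym b1 ∷ ~-sym b2 ∷ ~-sym b3 ∷ ~-sym b4 ∷ ~-sym b5 ∷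
     ~-sym 0t ∷ ~-sym 1t ∷ ~-sym 6t ∷ [])
    where
      open Cycle₇ c
      -- Fields of a hub of `rot^ j c` are numbered along the rotated cycle; renaming restores the
      -- indices of `c`.
      open Hub h₁ renaming (w to u₁; ∈I to ∈₁; h1 to a2; h2 to a3; h3 to a4; h4 to a5; h5 to a6; h6 to a0)
      open Hub h₆ renaming (w to u₆; ∈I to ∈₆; h1 to b0; h2 to b1; h3 to b2; h4 to b3; h5 to b4; h6 to b5)

  -- The total is 19 and the bound 10. Vertices of `I` miss at least 1 of the 11 on the cycle.
  -- Outside `I`, seeing `v0` rules out seeing both hubs, by absence of `T₀`, and `hub-twin` limits
  -- its second cycle neighbour.
  noT₀⇒noHubPair : ¬ ContainsSubgraph T₀ G →
    ∀ c → Hub (rot^ 1 c) → Hub (rot^ 6 c) → ⊥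
  noT₀⇒noHubPair ¬T₀ c h₁ h₆ = overweightᴵ 8 15 md
    ((5 , v0) ∷ (1 , v1) ∷ (1 , v2) ∷ (1 , v3) ∷ (1 , v4) ∷ (1 , v5) ∷ (1 , v6) ∷ (4 , u₁) ∷ (4 , u₆) ∷ []) 10
    ((7 ∷ []) ∷ (8 ∷ []) ∷ (0 ∷ 1 ∷ 2 ∷ 3 ∷ 4 ∷ 5 ∷ 6 ∷ []) ∷ [])
    ((0 ∷ 2 ∷ 7 ∷ []) ∷ (5 ∷ 0 ∷ 8 ∷ []) ∷ (0 ∷ 7 ∷ 8 ∷ []) ∷ cycleForbidden) _ _ refl refl
    (λ z Iz → (λ { (uz ∷ []) → indep u₁ z (Hub.∈I h₁) Iz uz })
            ∷ (λ { (uz ∷ []) → indep u₆ z (Hub.∈I h₆) Iz uz })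
            ∷ (λ { (a ∷ b ∷ d ∷ e ∷ f ∷ g ∷ h ∷ []) → wholeCycle c a b d e f g h }) ∷ [])
    (λ z ∉z → (λ { (0z ∷ 2z ∷ uz ∷ []) → hub-twin h₁ 0z 2z uz })
            ∷ (λ { (5z ∷ 0z ∷ uz ∷ []) → hub-twin h₆ 5z 0z uz })
            ∷ (λ { (0z ∷ 1z ∷ 6z ∷ []) → ¬T₀ (containsT₀ c h₁ h₆ ∉z 0z 1z 6z) })
            ∷ avoidCycle c z ∉z)
    where
      open Cycle₇ c
      open Hub h₁ using () renaming (w to u₁)
      open Hub h₆ using () renaming (w to u₆)

  -- The unequal hub weights attain exactly 7 of 13: outside `I` by both hubs with `v0`, or by `v5`,
  -- `v0` and `u₁`, for instance; in `I` by missing a single vertex of weight 1.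
  minDeg⇒noHubPair : MinDegGreater 7 13 G →
    ∀ c → Hub (rot^ 1 c) → Hub (rot^ 6 c) → ⊥
  minDeg⇒noHubPair md′ c h₁ h₆ = overweightᴵ 7 13 md′
    ((2 , v0) ∷ (1 , v1) ∷ (1 , v2) ∷ (1 , v3) ∷ (1 , v4) ∷ (1 , v5) ∷ (1 , v6) ∷ (4 , u₁) ∷ (1 , u₆) ∷ []) 7
    ((7 ∷ []) ∷ (8 ∷ []) ∷ (0 ∷ 1 ∷ 2 ∷ 3 ∷ 4 ∷ 5 ∷ 6 ∷ []) ∷ [])
    ((0 ∷ 2 ∷ 7 ∷ []) ∷ (5 ∷ 0 ∷ 8 ∷ []) ∷ cycleForbidden) _ _ refl refl
    (λ z Iz → (λ { (uz ∷ []) → indep u₁ z (Hub.∈I h₁) Iz uz })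
            ∷ (λ { (uz ∷ []) → indep u₆ z (Hub.∈I h₆) Iz uz })
            ∷ (λ { (a ∷ b ∷ d ∷ e ∷ f ∷ g ∷ h ∷ []) → wholeCycle c a b d e f g h }) ∷ [])
    (λ z ∉z → (λ { (0z ∷ 2z ∷ uz ∷ []) → hub-twin h₁ 0z 2z uz })
            ∷ (λ { (5z ∷ 0z ∷ uz ∷ []) → hub-twin h₆ 5z 0z uz })
            ∷ avoidCycle c z ∉z)
    where
      open Cycle₇ c
      open Hub h₁ using () renaming (w to u₁)
      open Hub h₆ using () renaming (w to u₆)

  -- Excluding seven-cycles when no two hubs miss vertices at distance two

  module _ (noHubPair : ∀ c → Hub (rot^ 1 c) → Hub (rot^ 6 c) → ⊥) where

    -- A hub missing `v0` rules out those missing `v2` and `v5`. If none misses `v3` or `v4`,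
    -- `hubsNear` applies; otherwise `hubsFar` does, based at `v0` or, when a hub missing `v6`
    -- (respectively `v1`) interferes, at `v3` (respectively `v4`).
    noHubs : ∀ c → ¬ Hub c
    noHubs c h0 with hub? (rot^ 3 c) | hub? (rot^ 4 c)
    ... | no ¬3 | no ¬4 = hubsNear c h0 ¬2 ¬3 ¬4 ¬5
      where
        ¬2 : ¬ Hub (rot^ 2 c)
        ¬2 h = noHubPair (rot^ 1 c) h h0
        ¬5 : ¬ Hub (rot^ 5 c)
        ¬5 h = noHubPair (rot^ 6 c) h0 h
    ... | yes h3 | _ with hub? (rot^ 6 c)
    ...   | no ¬6 = hubsFar c h0 (λ h → noHubPair (rot^ 2 c) h3 h) (λ h → noHubPair (rot^ 1 c) h h0)
                      (λ h → noHubPair (rot^ 6 c) h0 h) ¬6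
    ...   | yes h6 = hubsFar (rot^ 3 c) h3 (λ h → noHubPair (rot^ 5 c) h6 h) (λ h → noHubPair (rot^ 6 c) h0 h)
                       (λ h → noHubPair (rot^ 2 c) h3 h) (λ h → noHubPair (rot^ 1 c) h h0)
    noHubs c h0 | no _ | yes h4 with hub? (rot^ 1 c)
    ...   | no ¬1 = hubsFar c h0 ¬1 (λ h → noHubPair (rot^ 1 c) h h0)
                      (λ h → noHubPair (rot^ 6 c) h0 h) (λ h → noHubPair (rot^ 5 c) h h4)
    ...   | yes h1 = hubsFar (rot^ 4 c) h4 (λ h → noHubPair (rot^ 6 c) h0 h) (λ h → noHubPair (rot^ 5 c) h h4)
                       (λ h → noHubPair (rot^ 1 c) h h0) (λ h → noHubPair (rot^ 2 c) h h1)

    noCycle₇ : ¬ Cycle₇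
    noCycle₇ c = noHub c (noHubs c) (noHubs (rot^ 1 c)) (noHubs (rot^ 2 c)) (noHubs (rot^ 3 c))
      (noHubs (rot^ 4 c)) (noHubs (rot^ 5 c)) (noHubs (rot^ 6 c))

    Edgeᴼ : V → V → Set
    Edgeᴼ x y = x ~ y × I x ≡ false × I y ≡ false

    -- Shortest odd closed walks of length at least nine

    module Long {m : ℕ} {x : V} (closed : Walk Edgeᴼ (9 + m) x x) (L-odd : odd (9 + m) ≡ true)
      (noShorter : ∀ {l y} → l < 9 + m → odd l ≡ true → Walk Edgeᴼ l y y → ⊥) where

      L : ℕ
      L = 9 + m

      f : ℕ → V
      f = vertexAt closed

      step : ∀ i → i < L → Edgeᴼ (f i) (f (suc i))
      step = vertexAt-step closed

      f-end : f L ≡ f 0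
      f-end = vertexAt-end closed

      outside : ∀ i → i < L → I (f i) ≡ false
      outside i i<L = proj₁ (proj₂ (step i i<L))

      -- z closes each of the two arcs between f i and f (d + i); the odd one has length at least L.
      gap : ∀ {z} → I z ≡ false → ∀ d i → 0 < d → d + i < L → f i ~ z → f (d + i) ~ z → d ≡ 2 ⊎ L ≤ 2 + d
      gap {z} ∉z d i 0<d j<L iz jz with odd d in odd-d
      ... | true = inj₂ (≮⇒≥ λ short → noShorter (≤-trans (≤-reflexive (cong (2 +_) (+-comm d 1))) short)
              (cong not (trans (odd-+ d 1) (cong (_xor true) odd-d)))
              ((~-sym iz , ∉z , ∉i) ∷ (segment f i d (λ j _ j<d+i → step j (<-trans j<d+i j<L))
                ++ʷ (jz , ∉j , ∉z) ∷ [])))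
        where
          ∉i : I (f i) ≡ false
          ∉i = outside i (≤-<-trans (m≤n+m i d) j<L)
          ∉j : I (f (d + i)) ≡ false
          ∉j = outside (d + i) j<L
      -- With `d` even, the arc through the start of the walk has odd length `e + i`; closing it by
      -- `z` gives length `e + i + 2`, shorter than `e + d + i` unless `d ≤ 2`.
      ... | false = inj₁ (exactly d 0<d odd-d (≮⇒≥ λ 2<d → noShorter (short 2<d)
              (cong not (odd-gap e d i (trans (cong odd e+j) L-odd) odd-d))
              ((~-sym jz , ∉z , ∉j) ∷ (tail ++ʷ (head ++ʷ (iz , ∉i , ∉z) ∷ [])))))
        where
          i<L : i < L
          i<L = ≤-<-trans (m≤n+m i d) j<L
          ∉i : I (f i) ≡ false
          ∉i = outside i i<L
          ∉j : I (f (d + i)) ≡ false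
          ∉j = outside (d + i) j<L
          e : ℕ
          e = L ∸ (d + i)
          e+j : e + (d + i) ≡ L
          e+j = m∸n+n≡m (<⇒≤ j<L)
          tail : Walk Edgeᴼ e (f (d + i)) (f 0)
          tail = subst (Walk Edgeᴼ e (f (d + i))) (trans (cong f e+j) f-end)
                   (segment f (d + i) e (λ j _ j< → step j (subst (j <_) e+j j<)))
          head : Walk Edgeᴼ i (f 0) (f i)
          head = subst (λ j → Walk Edgeᴼ i (f 0) (f j)) (+-identityʳ i)
                   (segment f 0 i (λ j _ j< → step j (<-trans (subst (j <_) (+-identityʳ i) j<) i<L)))
          short : 2 < d → suc (e + (i + 1)) < L
          short 2<d = subst (suc (e + (i + 1)) <_) e+j (begin-strict
            suc (e + (i + 1))   ≡⟨ +-suc e (i + 1) ⟨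
            e + suc (i + 1)     <⟨ +-monoʳ-< e (s≤s (≤-reflexive (cong suc (+-comm i 1)))) ⟩
            e + (3 + i)         ≤⟨ +-monoʳ-≤ e (+-monoˡ-≤ i 2<d) ⟩
            e + (d + i)         ∎)
            where open ≤-Reasoning
          exactly : ∀ d → 0 < d → odd d ≡ false → d ≤ 2 → d ≡ 2
          exactly 2 _ _ _ = refl
          exactly (suc (suc (suc _))) _ _ (s≤s (s≤s ()))

      atLeastTwo : ∀ {d} → d ≡ 2 ⊎ L ≤ 2 + d → 2 ≤ d
      atLeastTwo (inj₁ refl)        = ≤-refl
      atLeastTwo (inj₂ (s≤s (s≤s le))) = ≤-trans (s≤s (s≤s z≤n)) le

      -- Two gaps of 2 add up to 4, which is neither 2 nor at least `L` minus 2. A gap of at least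
      -- `L` minus 2 together with another of at least 2 overruns the walk.
      gaps : ∀ {i d₁ d₂} → d₂ + (d₁ + i) < L → d₁ ≡ 2 ⊎ L ≤ 2 + d₁ → d₂ ≡ 2 ⊎ L ≤ 2 + d₂ →
        d₂ + d₁ ≡ 2 ⊎ L ≤ 2 + (d₂ + d₁) → ⊥
      gaps k<L (inj₁ refl) (inj₁ refl) (inj₁ ())
      gaps k<L (inj₁ refl) (inj₁ refl) (inj₂ (s≤s (s≤s (s≤s (s≤s (s≤s (s≤s ())))))))
      gaps {i} {d₁} {d₂} k<L (inj₂ L≤) g₂ _ =
        <⇒≱ k<L (≤-trans L≤ (+-mono-≤ (atLeastTwo g₂) (m≤m+n d₁ i)))
      gaps {i} {d₁} {d₂} k<L g₁@(inj₁ refl) (inj₂ L≤) _ =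
        <⇒≱ k<L (≤-trans L≤ (≤-trans (≤-reflexive (+-comm 2 d₂)) (+-monoʳ-≤ d₂ (m≤m+n 2 i))))

      sees : V → ℕ → Bool
      sees z i = adj G (f i) z

      outsideSees≤2 : ∀ {z} → I z ≡ false → count (sees z) L ≤ 2
      outsideSees≤2 {z} ∉z = ≮⇒≥ λ 2< →
        let (k , k<L , kz , 2≤) = count-last (sees z) L 2<
            (j , j<k , jz , 1≤) = count-last (sees z) k 2≤
            (i , i<j , iz , _)  = count-last (sees z) j 1≤
            d₁ = j ∸ i
            d₂ = k ∸ j
            j≡ = m∸n+n≡m (<⇒≤ i<j)
            k≡ = trans (cong (d₂ +_) j≡) (m∸n+n≡m (<⇒≤ j<k))
            k≡′ = trans (+-assoc d₂ d₁ i) k≡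
            j<L = <-trans j<k k<L
            d₁>0 = m<n⇒0<n∸m i<j
            d₂>0 = m<n⇒0<n∸m j<k
            k≡″ = m∸n+n≡m (<⇒≤ j<k)
        in gaps {i} {d₁} {d₂} (subst (_< L) (sym k≡) k<L)
             (gap ∉z d₁ i d₁>0 (subst (_< L) (sym j≡) j<L) iz (subst (λ v → f v ~ z) (sym j≡) jz))
             (gap ∉z d₂ j d₂>0 (subst (_< L) (sym k≡″) k<L) jz (subst (λ v → f v ~ z) (sym k≡″) kz))
             (gap ∉z (d₂ + d₁) i (≤-trans d₂>0 (m≤m+n d₂ d₁)) (subst (_< L) (sym k≡′) k<L) iz
               (subst (λ v → f v ~ z) (sym k≡′) kz))

      -- A vertex seeing every position would have the whole odd closed walk in its neighbourhood,
      -- an odd wheel.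
      insideSees<L : ∀ z → count (sees z) L < L
      insideSees<L z with count-max (sees z) L
      ... | inj₁ less = less
      ... | inj₂ full = ⊥-elim (noWheel lb z L-odd
              (subst (Walk (Around lb z) L (f 0)) (trans (cong f (+-identityʳ L)) f-end)
                (segment f 0 L (λ j _ j< → around j (subst (j <_) (+-identityʳ L) j<)))))
        where
          z~ : ∀ j → j ≤ L → z ~ f j
          z~ j j≤L with m≤n⇒m<n∨m≡n j≤L
          ... | inj₁ j<L  = ~-sym (full j j<L)
          ... | inj₂ refl = subst (z ~_) (sym f-end) (~-sym (full 0 (s≤s z≤n)))
          around : ∀ j → j < L → Around lb z (f j) (f (suc j))
          around j j<L = proj₁ (step j j<L) , z~ j (<⇒≤ j<L) , z~ (suc j) j<L

      -- A repeated vertex is listed once per occurrence, in agreement with `count` over positions.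
      along : ℕ → List (ℕ × V)
      along zero    = []
      along (suc i) = (1 , f i) ∷ along i

      total-along : ∀ l → total (along l) ≡ l
      total-along zero    = refl
      total-along (suc l) = cong suc (total-along l)

      seenWeight-along : ∀ z l → seenWeight (along l) z ≡ count (sees z) l
      seenWeight-along z zero    = refl
      seenWeight-along z (suc l) = cong (ind (sees z l) +_) (seenWeight-along z l)

      impossible : ⊥
      impossible with neighbourInI (outside 0 (s≤s z≤n))
      ... | u , Iu , _ = overweight 8 15 md xs (8 + m) (s≤s z≤n) enough bound
        where
          xs : List (ℕ × V)
          -- The weight `L` minus 3 on `u` balances the cases: `L` minus 1 in `I`, and 2 more than
          -- the weight of `u` outside. The required inequality 15(L - 1) ≤ 8(2L - 3) holds exactly
          -- from `L` = 9 on.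
          xs = (6 + m , u) ∷ along L

          enough : 15 * (8 + m) ≤ 8 * total xs
          enough = begin
            15 * (8 + m)                  ≡⟨ *-distribˡ-+ 15 8 m ⟩
            120 + 15 * m                  ≤⟨ +-monoʳ-≤ 120 (*-monoˡ-≤ m (≤ᵇ⇒≤ 15 16 _)) ⟩
            120 + 16 * m                  ≡⟨
              solve 1 (λ m → con 120 :+ con 16 :* m := con 8 :* ((con 6 :+ m) :+ (con 9 :+ m))) refl m ⟩
            8 * ((6 + m) + L)             ≡⟨ cong (λ l → 8 * ((6 + m) + l)) (total-along L) ⟨
            8 * total xs                  ∎
            where open ≤-Reasoning

          bound : ∀ z → seenWeight xs z ≤ 8 + m
          bound z rewrite seenWeight-along z L with I z in Iz | adj G u z in uz
          ... | true  | true  = ⊥-elim (indep u z Iu Iz uz)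
          ... | true  | false = ≤-pred (insideSees<L z)
          ... | false | true  = ≤-trans (+-monoʳ-≤ (6 + m) (outsideSees≤2 Iz)) (≤-reflexive (+-comm (6 + m) 2))
          ... | false | false = ≤-trans (outsideSees≤2 Iz) (s≤s (s≤s z≤n))

    -- Strong induction supplies minimality for length at least nine. `Cycle₅` and `Cycle₇` do not
    -- ask for distinct vertices, so closed walks of length five and seven qualify as they stand.
    noOddClosed : ∀ l → odd l ≡ true → ∀ {x} → Walk Edgeᴼ l x x → ⊥
    noOddClosed = <-rec (λ l → odd l ≡ true → ∀ {x} → Walk Edgeᴼ l x x → ⊥) go
      where
        go : ∀ l → (∀ {k} → k < l → odd k ≡ true → ∀ {x} → Walk Edgeᴼ k x x → ⊥) →
          odd l ≡ true → ∀ {x} → Walk Edgeᴼ l x x → ⊥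
        go 1 _ _ ((xx , _) ∷ []) = ~-irrefl xx
        go 3 _ _ ((xy , ∉x , ∉y) ∷ (yz , _ , ∉z) ∷ (zx , _) ∷ []) = triangle ∉x ∉y ∉z xy (~-sym zx) yz
        go 5 _ _ ((e01 , ∉0 , _) ∷ (e12 , ∉1 , _) ∷ (e23 , ∉2 , _) ∷ (e34 , ∉3 , ∉4) ∷ (e40 , _) ∷ []) =
          noCycle₅ record { ∉0 = ∉0 ; ∉1 = ∉1 ; ∉2 = ∉2 ; ∉3 = ∉3 ; ∉4 = ∉4
                          ; e01 = e01 ; e12 = e12 ; e23 = e23 ; e34 = e34 ; e40 = e40 }
        go 7 _ _ ((e01 , ∉0 , _) ∷ (e12 , ∉1 , _) ∷ (e23 , ∉2 , _) ∷ (e34 , ∉3 , _) ∷ (e45 , ∉4 , _) ∷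
                  (e56 , ∉5 , ∉6) ∷ (e60 , _) ∷ []) =
          noCycle₇ record { ∉0 = ∉0 ; ∉1 = ∉1 ; ∉2 = ∉2 ; ∉3 = ∉3 ; ∉4 = ∉4 ; ∉5 = ∉5 ; ∉6 = ∉6
                          ; e01 = e01 ; e12 = e12 ; e23 = e23 ; e34 = e34 ; e45 = e45 ; e56 = e56 ; e60 = e60 }
        go (suc (suc (suc (suc (suc (suc (suc (suc (suc m))))))))) rec l-odd w =
          Long.impossible w l-odd (λ k< k-odd v → rec k< k-odd v)

    -- One colour for `I`; the walks of `Edgeᴼ` stay outside it, and having no odd closed ones they
    -- yield the other two.
    threeColourable : ThreeColourable G
    threeColourable = colour , proper
      where
        edgeᴼ? : ∀ x y → Dec (Edgeᴼ x y)
        edgeᴼ? x y = (adj G x y Bool.≟ true) ×-dec (I x Bool.≟ false) ×-dec (I y Bool.≟ false)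

        edgeᴼ-sym : ∀ {x y} → Edgeᴼ x y → Edgeᴼ y x
        edgeᴼ-sym (xy , ∉x , ∉y) = ~-sym xy , ∉y , ∉x

        open TwoColouring Edgeᴼ edgeᴼ? edgeᴼ-sym (λ {k} k-odd → noOddClosed k k-odd)

        colour : V → Fin 3
        colour x = if I x then # 2 else if proj₁ twoColouring x then # 1 else # 0

        proper : ∀ x y → x ~ y → colour x ≢ colour y
        proper x y xy with I x in Ix | I y in Iy
        ... | true  | true  = ⊥-elim (indep x y Ix Iy xy)
        ... | true  | false with proj₁ twoColouring y
        ...   | true  = λ ()
        ...   | false = λ ()
        proper x y xy | false | true with proj₁ twoColouring x
        ...   | true  = λ ()
        ...   | false = λ ()
        proper x y xy | false | false
          with proj₁ twoColouring x | proj₁ twoColouring y | proj₂ twoColouring x y (xy , Ix , Iy)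
        ...   | true  | true  | ne = contradiction refl ne
        ...   | true  | false | _  = λ ()
        ...   | false | true  | _  = λ ()
        ...   | false | false | ne = contradiction refl ne

-- Cross-multiplied, 8 · 13 = 104 is less than 7 · 15 = 105.
7/13⇒8/15 : ∀ G → MinDegGreater 7 13 G → MinDegGreater 8 15 G
7/13⇒8/15 G md v = *-cancelˡ-< 13 _ _ (begin-strict
  13 * (8 * n G)        ≡⟨ *-assoc 13 8 (n G) ⟨
  104 * n G             ≤⟨ *-monoˡ-≤ (n G) (≤ᵇ⇒≤ 104 105 _) ⟩
  105 * n G             ≡⟨ *-assoc 15 7 (n G) ⟩
  15 * (7 * n G)        <⟨ *-monoʳ-< 15 (md v) ⟩
  15 * (13 * deg G v)   ≡⟨ x∙yz≈y∙xz *-commutativeSemigroup 15 13 (deg G v) ⟩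
  13 * (15 * deg G v)   ∎)
  where open ≤-Reasoning

theorem3p2 : (∀ (G : Graph) → LocallyBipartite G → MinDegGreater 8 15 G →
    ThreeColourable G ⊎ ContainsSubgraph H₀ G ⊎ ContainsSubgraph T₀ G)
    × (∀ (G : Graph) → LocallyBipartite G → MinDegGreater 7 13 G →
    ThreeColourable G ⊎ ContainsSubgraph H₀ G)
theorem3p2 =
  (λ G lb md → first G lb md (containsSubgraph? H₀ G) (containsSubgraph? T₀ G)) ,
  (λ G lb md → second G lb md (containsSubgraph? H₀ G))
  where
    first : ∀ G → LocallyBipartite G → MinDegGreater 8 15 G →
      Dec (ContainsSubgraph H₀ G) → Dec (ContainsSubgraph T₀ G) →
      ThreeColourable G ⊎ ContainsSubgraph H₀ G ⊎ ContainsSubgraph T₀ G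
    first G lb md (yes H₀⊆G) _          = inj₂ (inj₁ H₀⊆G)
    first G lb md (no _)     (yes T₀⊆G) = inj₂ (inj₂ T₀⊆G)
    first G lb md (no ¬H₀)   (no ¬T₀)   = inj₁ (threeColourable (noT₀⇒noHubPair ¬T₀))
      where open SpindleFree G lb md (λ uv uw vw → ¬H₀ (GraphFacts.moserSpindle G lb uv uw vw))

    second : ∀ G → LocallyBipartite G → MinDegGreater 7 13 G →
      Dec (ContainsSubgraph H₀ G) → ThreeColourable G ⊎ ContainsSubgraph H₀ G
    second G lb md (yes H₀⊆G) = inj₂ H₀⊆G
    -- The degree bound enters twice: weakened to 8/15 for the common argument, and in full to
    -- exclude hub pairs.
    second G lb md (no ¬H₀)   = inj₁ (threeColourable (minDeg⇒noHubPair md))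
      where open SpindleFree G lb (7/13⇒8/15 G md) (λ uv uw vw → ¬H₀ (GraphFacts.moserSpindle G lb uv uw vw))
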